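{- Let $v>k\geq 3$ be integers and let $D$ be a defining set for the full design $F(v,k)$. Then $$|D|\geq \binom{v}{k}\left[1-\frac{1+\sqrt{(32(v-k)+11)/3}}{2(v-k+1)}\right]=\binom{v}{k}\left(1-O\left((v-k)^{ -1/2}\right)\right).$$
   Context: $N(v)=\{1,\dots,v\}$. A $(v,k,\lambda)$-design is a collection (repeated blocks allowed) of $k$-element subsets (blocks) of $N(v)$ such that each unordered pair of distinct elements of $N(v)$ lies in exactly $\lambda$ blocks. The full design $F(v,k)$ consists of all $k$-subsets of $N(v)$, each once; it is a $(v,k,\binom{v-2}{k-2})$-design. A subset $D\subseteq F(v,k)$ is a defining set for $F(v,k)$ if $F(v,k)$ is the only $(v,k,\binom{v-2}{k-2})$-design (repeated blocks allowed) containing $D$. $|D|$ is the number of blocks in $D$. -}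

module Defs where

open import Data.Nat using (ℕ; _+_; _*_; _∸_; _^_; _≤_; suc)
open import Data.Nat.Combinatorics using (_C_)
open import Data.Bool using (Bool)
import Data.Bool.Properties as BoolP
open import Data.Fin using (Fin)
open import Data.Fin.Subset using (Subset; ∣_∣; _∈_)
open import Data.Fin.Subset.Properties using (_∈?_)
open import Data.Vec.Properties using (≡-dec)
open import Data.List using (List; length; filter)
open import Data.List.Relation.Unary.All using (All)
open import Data.List.Relation.Unary.Unique.Propositional using (Unique)
open import Data.List.Membership.Propositional renaming (_∈_ to _∈ₗ_)
open import Data.Product using (_×_)
open import Data.Sum using (_⊎_)
open import Relation.Binary.PropositionalEquality using (_≡_; _≢_)
open import Relation.Nullary using (Dec)
open import Relation.Nullary.Decidable using (_×-dec_)

-- Points are Fin v (playing the role of N(v) = {1,…,v}).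
-- A block is a subset of the points; a collection of blocks with
-- repetitions allowed is a list of subsets.

mult : ∀ {v} → Subset v → List (Subset v) → ℕ
mult s B = length (filter (λ b → ≡-dec BoolP._≟_ b s) B)

pairCount : ∀ {v} → Fin v → Fin v → List (Subset v) → ℕ
pairCount i j B = length (filter (λ b → (i ∈? b) ×-dec (j ∈? b)) B)

IsDesign : (v k lam : ℕ) → List (Subset v) → Set
IsDesign v k lam B =
  All (λ b → ∣ b ∣ ≡ k) B ×
  (∀ (i j : Fin v) → i ≢ j → pairCount i j B ≡ lam)

IsSubsetOfFull : (v k : ℕ) → List (Subset v) → Set
IsSubsetOfFull v k D = Unique D × All (λ b → ∣ b ∣ ≡ k) D

-- B equals the full design F(v,k) as a multiset: every k-subset occurs
-- exactly once (B has only k-subsets since it is a design with block size k)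
IsFull : (v k : ℕ) → List (Subset v) → Set
IsFull v k B = ∀ (s : Subset v) → ∣ s ∣ ≡ k → mult s B ≡ 1

IsDefiningSet : (v k : ℕ) → List (Subset v) → Set
IsDefiningSet v k D =
  IsSubsetOfFull v k D ×
  (∀ (B : List (Subset v)) →
     IsDesign v k ((v ∸ 2) C (k ∸ 2)) B →
     (∀ {s} → s ∈ₗ D → s ∈ₗ B) →
     IsFull v k B)

-- The bound  d ≥ C [1 - (1 + sqrt((32(v-k)+11)/3)) / (2(v-k+1))],  C = binom(v,k),
-- cleared of square roots and denominators: with a = 2(v-k+1)(C - d) it reads
-- a - C ≤ C sqrt((32(v-k)+11)/3), i.e.  a ≤ C  or  3(a - C)^2 ≤ C^2 (32(v-k)+11).
BoundHolds : (v k d : ℕ) → Set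
BoundHolds v k d =
  let bin = v C k
      a = 2 * (v ∸ k + 1) * (bin ∸ d)
  in a ≤ bin ⊎ 3 * (a ∸ bin) ^ 2 ≤ bin ^ 2 * (32 * (v ∸ k) + 11)

{-# OPTIONS --safe #-}
module Submission where

-- Call a k-set unused if it is not in D. Fix points z ≠ z′ and a (k - 3)-set S avoiding them, and let the
-- edges of a graph on the N = v - k + 1 remaining points be the pairs e for which e ∪ S ∪ {z} and
-- e ∪ S ∪ {z′} are unused. A nonzero f : E → {-1, 0, 1} with zero sum at every vertex would give another
-- design: change the multiplicity of e ∪ S ∪ {z} by f e and that of e ∪ S ∪ {z′} by - f e. So there is no
-- such f; this forces the cycles of the graph to be odd and pairwise vertex-disjoint, whence 3 |E| ≤ 4 N - 3.
--
-- For a (k - 1)-set P let d P be the number of unused k-sets containing P. Summing the edge bound over all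
-- (S , z , z′) gives 3 Σ d (d - 1) ≤ 2 (4 N - 3) C(v, k - 1), while Σ d is k times the number of unused sets;
-- the Cauchy-Schwarz inequality turns this into the quadratic inequality of the theorem.

-- Two disjoint odd cycles joined by a path are dependent only with coefficient 2 on the path, so
-- they may coexist: hence the 4 N / 3 instead of N. With c pairwise disjoint odd cycles and no
-- others there are at most N - 1 + c edges, and each cycle takes three vertices, so 3 c ≤ N.
--
-- The cycles are never classified. The count is carried by an induction that eliminates vertices of
-- degree at most 2. Eliminating one merges two edges into a signed edge, and an odd cycle shrinks
-- to a marked vertex at which a path may change its sign; signed multigraphs with marked vertices
-- are closed under both steps.
--
-- With p = C(v, k - 1) and G = Σ d the two final inequalities give 3 G² ≤ 3 p G + (8 N - 6) p²,
-- that is, 3 (2 G - p)² ≤ (32 N - 21) p². Since N = v - k + 1, this is the source of 32 (v - k) +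
-- 11.

open import Defs
open import Data.Nat using (ℕ; _<_; _≤_)
open import Data.List using (List; length)
open import Data.Fin.Subset using (Subset)

-- Signed multigraphs and their {-1, 0, 1}-dependencies

module SignedGraphs where

  open import Data.Bool using (Bool; true; false; _∨_; if_then_else_)
  import Data.Bool.Properties as BoolP
  open import Data.Empty using (⊥-elim)
  open import Data.Integer as ℤ using (ℤ; 0ℤ; 1ℤ)
  import Data.Integer.Properties as ℤP
  import Data.Integer.Solver as ℤSolver
  open import Data.List using ([]; _∷_; _++_; map; filter)
  open import Data.List.Membership.Propositional using (_∈_; _∉_)
  open import Data.List.Membership.Propositional.Properties using (∈-∃++; ∈-map⁻; ∈-++⁺ʳ)
  open import Data.List.Properties using (filter-none; filter-++; length-++; partition-defn)
  open import Data.List.Relation.Binary.Permutation.Propositional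
    using (_↭_; refl; prep; swap; trans; ↭-sym; ↭-trans; ↭⇒↭ₛ; ↭ₛ⇒↭)
  open import Data.List.Relation.Binary.Permutation.Propositional.Properties
    using (shift; shifts; filter-↭; ↭-length; map⁺; ++⁺ˡ; ++⁺ʳ; All-resp-↭; ∈-resp-↭; ++-comm)
  import Data.List.Relation.Binary.Permutation.Setoid.Properties as SetoidPerm
  open import Data.List.Relation.Unary.All as All using (All; []; _∷_)
  open import Data.List.Relation.Unary.All.Properties using (all-filter)
  open import Data.List.Relation.Unary.AllPairs as AllPairs using (AllPairs; []; _∷_)
  open import Data.List.Relation.Unary.Any using (here; there)
  open import Data.List.Relation.Unary.Unique.Propositional using (Unique)
  open import Data.Nat as ℕ using (zero; suc; z≤n; s≤s)
  open import Data.Nat.ListAction using (sum)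
  open import Data.Nat.ListAction.Properties using (sum-↭)
  import Data.Nat.Properties as ℕP
  import Data.Nat.Tactic.RingSolver as ℕSolver
  open import Data.Product using (∃; ∃₂; _×_; _,_; proj₁; proj₂)
  open import Data.Sign as Sign using (Sign; +; -; opposite)
  open import Data.Sum using (_⊎_; inj₁; inj₂)
  open import Function using (_∘_)
  open import Level using (0ℓ)
  open import Relation.Binary.Core using (Rel)
  open import Relation.Binary.Definitions using (DecidableEquality; Symmetric)
  open import Relation.Binary.PropositionalEquality
    using (_≡_; _≢_; refl; sym; cong; subst; setoid; resp₂) renaming (trans to ≡-trans)
  open import Relation.Nullary using (¬_; Dec; yes; no; does)
  open import Relation.Nullary.Decidable using (_⊎-dec_; ¬?)
  open import Relation.Unary using (Decidable)

  infixr 8 _·_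

  _·_ : Sign → ℤ → ℤ
  + · z = z
  - · z = ℤ.- z

  open ℤSolver.+-*-Solver using (Polynomial; solve; _:+_; _:-_; :-_; _:=_; con)

  infixr 9 _⊙_

  -- Mirror of `_·_` on polynomials. For concrete signs both compute away, so a signed identity
  -- splits into finitely many ring identities.
  _⊙_ : ∀ {n} → Sign → Polynomial n → Polynomial n
  + ⊙ p = p
  - ⊙ p = :- p

  -- An edge x y of kind fix σ has the vector δ x + σ δ y; one of kind any may use either sign, like a path
  -- from x to y through an odd cycle.
  data Kind : Set where
    fix : Sign → Kind
    any : Kind

  data Allows : Kind → Sign → Set where
    fixed : ∀ {σ} → Allows (fix σ) σ
    free  : ∀ {σ} → Allows any σ

  some-sign : ∀ κ → ∃ (Allows κ)
  some-sign (fix σ) = σ , fixed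
  some-sign any     = + , free

  record Edge (V : Set) : Set where
    constructor edge
    field
      src dst : V
      kind    : Kind
      weight  : ℕ

  open Edge

  filter-split : ∀ {A : Set} {P : A → Set} (P? : Decidable P) (xs : List A) →
                 xs ↭ filter P? xs ++ filter (¬? ∘ P?) xs
  filter-split P? xs = subst (λ yszs → xs ↭ proj₁ yszs ++ proj₂ yszs) (partition-defn P? xs)
    (↭ₛ⇒↭ (SetoidPerm.partition-↭ (setoid _) P? xs))

  allPairs-↭ : ∀ {A : Set} {R : Rel A 0ℓ} → Symmetric R → ∀ {xs ys} → xs ↭ ys → AllPairs R xs → AllPairs R ys
  allPairs-↭ {R = R} sy π = SetoidPerm.AllPairs-resp-↭ (setoid _) sy (resp₂ R) (↭⇒↭ₛ π)

  unique-↭ : ∀ {A : Set} {xs ys : List A} → xs ↭ ys → Unique xs → Unique ys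
  unique-↭ = allPairs-↭ (_∘ sym)

  ∈-↭ : ∀ {A : Set} {x : A} {xs} → x ∈ xs → ∃ λ ys → xs ↭ x ∷ ys
  ∈-↭ {x = x} x∈xs with as , bs , refl ← ∈-∃++ x∈xs = as ++ bs , shift x as bs

  module SignedGraph {V : Set} (_≟_ : DecidableEquality V) where

    δ : V → V → ℤ
    δ x p with does (x ≟ p)
    ... | true  = 1ℤ
    ... | false = 0ℤ

    term : Sign → V → Sign → V → V → ℤ
    term ε x σ y p = ε · (δ x p ℤ.+ σ · δ y p)

    -- Comb es nz b : b is a {-1, 0, 1}-combination of the vectors of es, with a nonzero coefficient iff nz.
    data Comb : List (Edge V) → Bool → (V → ℤ) → Set where
      done : ∀ {b} → (∀ p → b p ≡ 0ℤ) → Comb [] false b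
      skip : ∀ {e es nz b} → Comb es nz b → Comb (e ∷ es) nz b
      take : ∀ {e es nz b b′} ε {σ} → Allows (kind e) σ → Comb es nz b →
             (∀ p → b′ p ≡ term ε (src e) σ (dst e) p ℤ.+ b p) → Comb (e ∷ es) true b′

    Trade : List (Edge V) → Set
    Trade es = Comb es true (λ _ → 0ℤ)

    comb-resp : ∀ {es nz b b′} → (∀ p → b′ p ≡ b p) → Comb es nz b → Comb es nz b′
    comb-resp eq (done z)       = done λ p → ≡-trans (eq p) (z p)
    comb-resp eq (skip c)       = skip (comb-resp eq c)
    comb-resp eq (take ε a c q) = take ε a c λ p → ≡-trans (eq p) (q p)

    comb-zero : ∀ es → Comb es false (λ _ → 0ℤ)
    comb-zero []       = done λ _ → refl
    comb-zero (e ∷ es) = skip (comb-zero es)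

    ·-neg : ∀ ε z → ℤ.- (ε · z) ≡ opposite ε · z
    ·-neg + z = refl
    ·-neg - z = ℤP.neg-involutive z

    comb-neg : ∀ {es nz b} → Comb es nz b → Comb es nz (λ p → ℤ.- b p)
    comb-neg (done z)       = done λ p → cong ℤ.-_ (z p)
    comb-neg (skip c)       = skip (comb-neg c)
    comb-neg {e ∷ _} (take {b = b} ε {σ} a c q) = take (opposite ε) a (comb-neg c) λ p →
      ≡-trans (cong ℤ.-_ (q p))
        (≡-trans (ℤP.neg-distrib-+ (term ε (src e) σ (dst e) p) (b p))
          (cong (ℤ._+ (ℤ.- b p)) (·-neg ε _)))

    comb-skips : ∀ ds {es nz b} → Comb es nz b → Comb (ds ++ es) nz b
    comb-skips []       c = c
    comb-skips (d ∷ ds) c = skip (comb-skips ds c)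

    comb-++ : ∀ {es fs nz nz′ b b′} → Comb es nz b → Comb fs nz′ b′ →
              Comb (es ++ fs) (nz ∨ nz′) (λ p → b p ℤ.+ b′ p)
    comb-++ {b′ = b′} (done z) d = comb-resp (λ p → ≡-trans (cong (ℤ._+ b′ p) (z p)) (ℤP.+-identityˡ (b′ p))) d
    comb-++ (skip c)       d = skip (comb-++ c d)
    comb-++ {e ∷ _} {b′ = b′} (take {b = b} ε {σ} a c q) d = take ε a (comb-++ c d) λ p →
      ≡-trans (cong (ℤ._+ b′ p) (q p)) (ℤP.+-assoc (term ε (src e) σ (dst e) p) (b p) (b′ p))

    comb-↭ : ∀ {es fs nz b} → es ↭ fs → Comb es nz b → Comb fs nz b
    comb-↭ refl c = c
    comb-↭ (prep e π) (skip c)       = skip (comb-↭ π c)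
    comb-↭ (prep e π) (take ε a c q) = take ε a (comb-↭ π c) q
    comb-↭ (swap e f π) (skip (skip c))       = skip (skip (comb-↭ π c))
    comb-↭ (swap e f π) (skip (take ε a c q)) = take ε a (skip (comb-↭ π c)) q
    comb-↭ (swap e f π) (take ε a (skip c) q) = skip (take ε a (comb-↭ π c) q)
    comb-↭ (swap e f π) (take ε {σ} a (take {b = b} ε′ {σ′} a′ c q′) q) =
      take ε′ a′ (take ε a (comb-↭ π c) λ _ → refl) λ p →
        ≡-trans (q p) (≡-trans (cong (ℤ._+_ (t p)) (q′ p)) (x∙yz≈y∙xz (t p) (term ε′ (src f) σ′ (dst f) p) (b p)))
      where
      open import Algebra.Properties.CommutativeSemigroup ℤP.+-commutativeSemigroup using (x∙yz≈y∙xz)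
      t = term ε (src e) σ (dst e)
    comb-↭ (trans π ρ) c = comb-↭ ρ (comb-↭ π c)

    -- Merging two edges at a common vertex

    Joins : Edge V → V → V → Set
    Joins e a x = (src e ≡ a × dst e ≡ x) ⊎ (src e ≡ x × dst e ≡ a)

    -- As σ² = 1, exchanging the ends of an edge only multiplies its vector by σ; edges can be
    -- traversed in either direction.
    term-flip : ∀ ε x σ y p → term ε x σ y p ≡ term (ε Sign.* σ) y σ x p
    term-flip ε x σ y p = flip ε σ (δ x p) (δ y p)
      where
      polynomials : ∀ {n} → Sign → Sign → (a b : Polynomial n) → Polynomial n × Polynomial n
      polynomials ε σ a b =
        ε ⊙ (a :+ σ ⊙ b) := (ε Sign.* σ) ⊙ (b :+ σ ⊙ a)
      flip : ∀ ε σ a b →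
        ε · (a ℤ.+ σ · b) ≡ (ε Sign.* σ) · (b ℤ.+ σ · a)
      flip + + = solve 2 (polynomials + +) refl
      flip + - = solve 2 (polynomials + -) refl
      flip - + = solve 2 (polynomials - +) refl
      flip - - = solve 2 (polynomials - -) refl

    take-joins : ∀ {e a x es nz b b′ σ} → Joins e a x → ∀ ε → Allows (kind e) σ → Comb es nz b →
                 (∀ p → b′ p ≡ term ε a σ x p ℤ.+ b p) → Comb (e ∷ es) true b′
    take-joins (inj₁ (refl , refl)) ε al c q = take ε al c q
    take-joins {a = a} {x} {b = b} {σ = σ} (inj₂ (refl , refl)) ε al c q = take (ε Sign.* σ) al c λ p →
      ≡-trans (q p) (cong (ℤ._+ b p) (term-flip ε a σ x p))

    -- Eliminating a from a + σ x and a + τ y leaves σ x - τ y = σ (x - σ τ y), an edge x y of sign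
    -- - σ τ. If one of the two signs is free, so is the result.
    mergeKind : Kind → Kind → Kind
    mergeKind (fix σ) (fix τ) = fix (opposite (σ Sign.* τ))
    mergeKind (fix _) any     = any
    mergeKind any     _       = any

    mergeKind-split : ∀ κ κ′ {ρ} → Allows (mergeKind κ κ′) ρ →
      ∃₂ λ σ τ → Allows κ σ × Allows κ′ τ × ρ ≡ opposite (σ Sign.* τ)
    mergeKind-split (fix σ) (fix τ) fixed = σ , τ , fixed , fixed , refl
    mergeKind-split (fix σ) any {ρ} free  = σ , opposite (σ Sign.* ρ) , fixed , free , eq σ ρ
      where
      eq : ∀ σ ρ → ρ ≡ opposite (σ Sign.* opposite (σ Sign.* ρ))
      eq + + = refl
      eq + - = refl
      eq - + = refl
      eq - - = refl
    mergeKind-split any κ′ {ρ} free with τ , al ← some-sign κ′ = opposite (ρ Sign.* τ) , τ , free , al , eq ρ τ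
      where
      eq : ∀ ρ τ → ρ ≡ opposite (opposite (ρ Sign.* τ) Sign.* τ)
      eq + + = refl
      eq + - = refl
      eq - + = refl
      eq - - = refl

    difference-polynomials : ∀ {n} → Sign → Sign → Sign → (a x y b : Polynomial n) → Polynomial n × Polynomial n
    difference-polynomials ε σ τ a x y b =
      ε ⊙ (x :+ opposite (σ Sign.* τ) ⊙ y) :+ b := (ε Sign.* σ) ⊙ (a :+ σ ⊙ x) :+ (opposite (ε Sign.* σ) ⊙ (a :+ τ ⊙ y) :+ b)

    difference-identity : ∀ ε σ τ a x y b →
      ε · (x ℤ.+ opposite (σ Sign.* τ) · y) ℤ.+ b ≡ (ε Sign.* σ) · (a ℤ.+ σ · x) ℤ.+ (opposite (ε Sign.* σ) · (a ℤ.+ τ · y) ℤ.+ b)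
    difference-identity + + + = solve 4 (difference-polynomials + + +) refl
    difference-identity + + - = solve 4 (difference-polynomials + + -) refl
    difference-identity + - + = solve 4 (difference-polynomials + - +) refl
    difference-identity + - - = solve 4 (difference-polynomials + - -) refl
    difference-identity - + + = solve 4 (difference-polynomials - + +) refl
    difference-identity - + - = solve 4 (difference-polynomials - + -) refl
    difference-identity - - + = solve 4 (difference-polynomials - - +) refl
    difference-identity - - - = solve 4 (difference-polynomials - - -) refl

    sum-polynomials : ∀ {n} → Sign → Sign → Sign → (a x y b : Polynomial n) → Polynomial n × Polynomial n
    sum-polynomials ε σ τ a x y b =
      ε ⊙ (x :+ (σ Sign.* τ) ⊙ y) :+ b := (ε Sign.* σ) ⊙ (a :+ σ ⊙ x) :+ ((ε Sign.* σ) ⊙ (a :+ τ ⊙ y) :+ (opposite (ε Sign.* σ) ⊙ (a :+ a) :+ b))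

    sum-identity : ∀ ε σ τ a x y b →
      ε · (x ℤ.+ (σ Sign.* τ) · y) ℤ.+ b ≡ (ε Sign.* σ) · (a ℤ.+ σ · x) ℤ.+ ((ε Sign.* σ) · (a ℤ.+ τ · y) ℤ.+ (opposite (ε Sign.* σ) · (a ℤ.+ a) ℤ.+ b))
    sum-identity + + + = solve 4 (sum-polynomials + + +) refl
    sum-identity + + - = solve 4 (sum-polynomials + + -) refl
    sum-identity + - + = solve 4 (sum-polynomials + - +) refl
    sum-identity + - - = solve 4 (sum-polynomials + - -) refl
    sum-identity - + + = solve 4 (sum-polynomials - + +) refl
    sum-identity - + - = solve 4 (sum-polynomials - + -) refl
    sum-identity - - + = solve 4 (sum-polynomials - - +) refl
    sum-identity - - - = solve 4 (sum-polynomials - - -) refl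

    -- Alternating signs around an odd cycle, starting and ending at x, add up to ± 2 δ x; the loop
    -- has this vector.
    loop : V → Edge V
    loop x = edge x x (fix +) 0

    -- The coefficient ε of the merged edge becomes ε σ on `e` and - ε σ on `f`: the entries at `a`
    -- cancel and no coefficient exceeds 1 in absolute value.
    eliminate : ∀ {e f a x y w es nz b} → Joins e a x → Joins f a y →
      Comb (edge x y (mergeKind (kind e) (kind f)) w ∷ es) nz b → Comb (e ∷ f ∷ es) nz b
    eliminate je jf (skip c) = skip (skip c)
    eliminate {e} {f} {a} {x} {y} je jf (take {b = b} ε al c q)
      with σ , τ , alσ , alτ , refl ← mergeKind-split (kind e) (kind f) al =
      take-joins je (ε Sign.* σ) alσ (take-joins jf (opposite (ε Sign.* σ)) alτ c λ _ → refl) λ p →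
        ≡-trans (q p) (difference-identity ε σ τ (δ a p) (δ x p) (δ y p) (b p))

    sign-≟ : ∀ (σ τ : Sign) → τ ≡ σ ⊎ τ ≡ opposite σ
    sign-≟ + + = inj₁ refl
    sign-≟ + - = inj₂ refl
    sign-≟ - + = inj₂ refl
    sign-≟ - - = inj₁ refl

    -- A loop at `a` makes both signs available: opposite coefficients on `e` and `f` cancel at `a`,
    -- and equal ones leave ± 2 δ a, which the loop absorbs.
    eliminate-flagged : ∀ {e f a x y w es nz b} → Joins e a x → Joins f a y →
      Comb (edge x y any w ∷ es) nz b → Comb (e ∷ f ∷ loop a ∷ es) nz b
    eliminate-flagged je jf (skip c) = skip (skip (skip c))
    eliminate-flagged {e} {f} {a} {x} {y} je jf (take {b = b} ε {ρ} al c q)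
      with σ , alσ ← some-sign (kind e) | τ , alτ ← some-sign (kind f)
      with sign-≟ (σ Sign.* τ) ρ
    ... | inj₂ refl =
      take-joins je (ε Sign.* σ) alσ (take-joins jf (opposite (ε Sign.* σ)) alτ (skip c) λ _ → refl) λ p →
        ≡-trans (q p) (difference-identity ε σ τ (δ a p) (δ x p) (δ y p) (b p))
    ... | inj₁ refl =
      take-joins je (ε Sign.* σ) alσ
        (take-joins jf (ε Sign.* σ) alτ (take (opposite (ε Sign.* σ)) fixed c λ _ → refl) λ _ → refl) λ p →
        ≡-trans (q p) (sum-identity ε σ τ (δ a p) (δ x p) (δ y p) (b p))

    -- Minimum degree three forces a dependency

    open import Data.List.Membership.DecPropositional _≟_ using (_∈?_)

    Incident : V → Edge V → Set
    Incident a e = src e ≡ a ⊎ dst e ≡ a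

    incident? : ∀ a → Decidable (Incident a)
    incident? a e = (src e ≟ a) ⊎-dec (dst e ≟ a)

    incident⇒joins : ∀ {a e} → Incident a e → ∃ (Joins e a)
    incident⇒joins {e = e} (inj₁ refl) = dst e , inj₁ (refl , refl)
    incident⇒joins {e = e} (inj₂ refl) = src e , inj₂ (refl , refl)

    star : V → List (Edge V) → List (Edge V)
    star a = filter (incident? a)

    degree : V → List (Edge V) → ℕ
    degree a es = length (star a es)

    degree-split : ∀ a {es fs gs} → es ↭ fs ++ gs → degree a es ≡ degree a fs ℕ.+ degree a gs
    degree-split a {es} {fs} {gs} π =
      ≡-trans (↭-length (filter-↭ (incident? a) π))
        (≡-trans (cong length (filter-++ (incident? a) fs gs)) (length-++ (star a fs)))

    EndsIn : List V → Edge V → Set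
    EndsIn vs e = src e ∈ vs × dst e ∈ vs

    joins-endsIn : ∀ {e a x vs} → Joins e a x → EndsIn vs e → x ∈ vs
    joins-endsIn (inj₁ (refl , refl)) (_ , x∈) = x∈
    joins-endsIn (inj₂ (refl , refl)) (x∈ , _) = x∈

    -- A tree with sign labels: any two labelled vertices are connected by an alternating path.
    SpannedBy : List (Edge V) → List (V × Sign) → Set
    SpannedBy es ts = ∀ {p σ q τ} → (p , σ) ∈ ts → (q , τ) ∈ ts →
      ∃ λ nz → Comb es nz (λ z → σ · δ p z ℤ.- τ · δ q z)

    -- The label is forced: - σ (q + τ x) added to σ q - r leaves - σ τ x - r. The edge `e` is new,
    -- so it enters each combination at most once.
    spanned-extend : ∀ {e q x σ es ts} τ → Allows (kind e) τ → Joins e q x →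
      SpannedBy es ((q , σ) ∷ ts) → SpannedBy (e ∷ es) ((x , opposite (σ Sign.* τ)) ∷ (q , σ) ∷ ts)
    spanned-extend {e} {q} {x} {σ} {es} {ts} τ al j sp = λ where
        (here refl) (here refl) → false , skip (comb-resp (λ z → ℤP.+-inverseʳ (ρ · δ x z)) (comb-zero es))
        (here refl) (there r∈)  → new r∈
        (there r∈)  (here refl) → new⁻ r∈
        (there p∈)  (there r∈)  → let nz , c = sp p∈ r∈ in nz , skip c
      where
      ρ = opposite (σ Sign.* τ)
      anti : ∀ a b → b ℤ.- a ≡ ℤ.- (a ℤ.- b)
      anti = solve 2 (λ a b → b :- a := :- (a :- b)) refl
      polynomials : ∀ {n} → Sign → Sign → (q x r : Polynomial n) → Polynomial n × Polynomial n
      polynomials σ τ q x r =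
        opposite (σ Sign.* τ) ⊙ x :- r := opposite σ ⊙ (q :+ τ ⊙ x) :+ (σ ⊙ q :- r)
      eq : ∀ σ τ q x r →
        opposite (σ Sign.* τ) · x ℤ.- r ≡ opposite σ · (q ℤ.+ τ · x) ℤ.+ (σ · q ℤ.- r)
      eq + + = solve 3 (polynomials + +) refl
      eq + - = solve 3 (polynomials + -) refl
      eq - + = solve 3 (polynomials - +) refl
      eq - - = solve 3 (polynomials - -) refl
      new : ∀ {r υ} → (r , υ) ∈ (q , σ) ∷ ts → ∃ λ nz → Comb (e ∷ es) nz (λ z → ρ · δ x z ℤ.- υ · δ r z)
      new {r} {υ} r∈ with nz , c ← sp (here refl) r∈ =
        true , take-joins j (opposite σ) al c λ z → eq σ τ (δ q z) (δ x z) (υ · δ r z)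
      new⁻ : ∀ {r υ} → (r , υ) ∈ (q , σ) ∷ ts → ∃ λ nz → Comb (e ∷ es) nz (λ z → υ · δ r z ℤ.- ρ · δ x z)
      new⁻ {r} {υ} r∈ with nz , c ← new r∈ =
        nz , comb-resp (λ z → anti (ρ · δ x z) (υ · δ r z)) (comb-neg c)

    even-cycle-polynomials : ∀ {n} → Sign → Sign → (q x : Polynomial n) → Polynomial n × Polynomial n
    even-cycle-polynomials σ τ q x =
      con 0ℤ := opposite σ ⊙ (q :+ τ ⊙ x) :+ (σ ⊙ q :- opposite (σ Sign.* τ) ⊙ x)

    even-cycle-identity : ∀ σ τ q x →
      0ℤ ≡ opposite σ · (q ℤ.+ τ · x) ℤ.+ (σ · q ℤ.- opposite (σ Sign.* τ) · x)
    even-cycle-identity + + = solve 2 (even-cycle-polynomials + +) refl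
    even-cycle-identity + - = solve 2 (even-cycle-polynomials + -) refl
    even-cycle-identity - + = solve 2 (even-cycle-polynomials - +) refl
    even-cycle-identity - - = solve 2 (even-cycle-polynomials - -) refl

    odd-cycles-polynomials : ∀ {n} → Sign → Sign → Sign → (q x y : Polynomial n) → Polynomial n × Polynomial n
    odd-cycles-polynomials σ τ τ′ q x y =
      con 0ℤ := σ ⊙ (q :+ τ ⊙ x) :+ (opposite σ ⊙ (q :+ τ′ ⊙ y) :+ ((σ Sign.* τ′) ⊙ y :- (σ Sign.* τ) ⊙ x))

    odd-cycles-identity : ∀ σ τ τ′ q x y →
      0ℤ ≡ σ · (q ℤ.+ τ · x) ℤ.+ (opposite σ · (q ℤ.+ τ′ · y) ℤ.+ ((σ Sign.* τ′) · y ℤ.- (σ Sign.* τ) · x))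
    odd-cycles-identity + + + = solve 3 (odd-cycles-polynomials + + +) refl
    odd-cycles-identity + + - = solve 3 (odd-cycles-polynomials + + -) refl
    odd-cycles-identity + - + = solve 3 (odd-cycles-polynomials + - +) refl
    odd-cycles-identity + - - = solve 3 (odd-cycles-polynomials + - -) refl
    odd-cycles-identity - + + = solve 3 (odd-cycles-polynomials - + +) refl
    odd-cycles-identity - + - = solve 3 (odd-cycles-polynomials - + -) refl
    odd-cycles-identity - - + = solve 3 (odd-cycles-polynomials - - +) refl
    odd-cycles-identity - - - = solve 3 (odd-cycles-polynomials - - -) refl

    -- An edge from q back into the tree closes an even cycle, or an odd one; two odd ones through q combine.
    spanned-close : ∀ {e f q x y σ σˣ σʸ es ts} → Joins e q x → Joins f q y → SpannedBy es ((q , σ) ∷ ts) →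
      (x , σˣ) ∈ (q , σ) ∷ ts → (y , σʸ) ∈ (q , σ) ∷ ts → Trade (e ∷ f ∷ es)
    spanned-close {e} {f} {q} {x} {y} {σ} {σˣ} {σʸ} {es} {ts} je jf sp x∈ y∈
      with some-sign (kind e) | some-sign (kind f)
    ... | τ , al | τ′ , al′ with sign-≟ (σ Sign.* τ) σˣ | sign-≟ (σ Sign.* τ′) σʸ
    ... | inj₂ refl | _ with nz , c ← sp (here refl) x∈ =
      take-joins je (opposite σ) al (skip c) λ z → even-cycle-identity σ τ (δ q z) (δ x z)
    ... | inj₁ _ | inj₂ refl with nz , c ← sp (here refl) y∈ =
      skip (take-joins jf (opposite σ) al′ c λ z → even-cycle-identity σ τ′ (δ q z) (δ y z))
    -- The tree joins `y` to `x` directly. Adding the two odd cycles through `q` instead could use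
    -- their common edges twice.
    ... | inj₁ refl | inj₁ refl with nz , c ← sp y∈ x∈ =
      take-joins je σ al (take-joins jf (opposite σ) al′ c λ _ → refl) λ z → odd-cycles-identity σ τ τ′ (δ q z) (δ x z) (δ y z)

    module _ {vs es} (ends : All (EndsIn vs) es) (dense : ∀ {a} → a ∈ vs → 3 ≤ degree a es) where

      -- State of a search that always attaches the next vertex to the latest one, `q`, so the tree
      -- is a path ending there. `U` holds its edges and `R` all others; as at most one edge of `U`
      -- meets `q`, at least two edges of `R` do.
      record Exploration (unseen : List V) : Set where
        field
          {q}    : V
          {σ}    : Sign
          {ts}   : List (V × Sign)
          {U R}  : List (Edge V)
        seen : List V
        seen = map proj₁ ((q , σ) ∷ ts)
        field
          q∈vs   : q ∈ vs
          split  : es ↭ U ++ R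
          tree   : SpannedBy U ((q , σ) ∷ ts)
          closed : All (EndsIn seen) U
          last   : degree q U ≤ 1
          cover  : ∀ {x} → x ∈ vs → x ∈ seen ⊎ x ∈ unseen

      -- Of two edges of `R` at `q`, either one leads to an unseen vertex and the path grows, or
      -- both lead back into the path and `spanned-close` applies.
      explore-step : ∀ {unseen} → Exploration unseen →
        Trade es ⊎ ∃ λ unseen′ → Exploration unseen′ × length unseen ≡ suc (length unseen′)
      explore-step {unseen} s = branch (star q R) (all-filter (incident? q) R) (filter-split (incident? q) R) two
        where
        open Exploration s

        two : 2 ≤ length (star q R)
        two = ℕP.+-cancelˡ-≤ 1 2 _ (ℕP.≤-trans (dense q∈vs)
          (ℕP.≤-trans (ℕP.≤-reflexive (degree-split q {fs = U} {gs = R} split)) (ℕP.+-monoˡ-≤ _ last)))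

        extend : ∀ {e x R′} → R ↭ e ∷ R′ → Joins e q x → x ∈ vs → x ∉ seen →
          ∃ λ unseen′ → Exploration unseen′ × length unseen ≡ suc (length unseen′)
        extend {e} {x} {R′} π j x∈vs x∉seen with cover x∈vs
        ... | inj₁ x∈seen = ⊥-elim (x∉seen x∈seen)
        ... | inj₂ x∈unseen with unseen′ , ρ ← ∈-↭ x∈unseen = unseen′ , next , ↭-length ρ
          where
          τ = proj₁ (some-sign (kind e))

          joins-ends : ∀ {zs} → Joins e q x → q ∈ zs → x ∈ zs → EndsIn zs e
          joins-ends (inj₁ (refl , refl)) q∈ x∈ = q∈ , x∈
          joins-ends (inj₂ (refl , refl)) q∈ x∈ = x∈ , q∈

          fresh : ∀ {f} → EndsIn seen f → ¬ Incident x f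
          fresh (s∈ , _) (inj₁ refl) = x∉seen s∈
          fresh (_ , d∈) (inj₂ refl) = x∉seen d∈

          last′ : degree x (e ∷ U) ≤ 1
          last′ with does (incident? x e)
          ... | true  = s≤s (ℕP.≤-reflexive (cong length (filter-none (incident? x) (All.map (λ {f} → fresh {f}) closed))))
          ... | false = ℕP.≤-trans (ℕP.≤-reflexive (cong length (filter-none (incident? x) (All.map (λ {f} → fresh {f}) closed)))) z≤n

          cover′ : ∀ {y} → y ∈ vs → y ∈ x ∷ seen ⊎ y ∈ unseen′
          cover′ y∈vs with cover y∈vs
          ... | inj₁ y∈seen = inj₁ (there y∈seen)
          ... | inj₂ y∈unseen with ∈-resp-↭ ρ y∈unseen
          ...   | here refl = inj₁ (here refl)
          ...   | there y∈  = inj₂ y∈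

          next : Exploration unseen′
          next = record
            { q∈vs   = x∈vs
            ; split  = ↭-trans split (↭-trans (++⁺ˡ U π) (shift e U R′))
            ; tree   = spanned-extend τ (proj₂ (some-sign (kind e))) j tree
            ; closed = joins-ends j (there (here refl)) (here refl) ∷ All.map (λ (s∈ , d∈) → there s∈ , there d∈) closed
            ; last   = last′
            ; cover  = cover′
            }

        R-ends : All (EndsIn vs) R
        R-ends = All.tabulate λ f∈ → All.lookup ends (∈-resp-↭ (↭-sym split) (∈-++⁺ʳ U f∈))

        branch : ∀ inc {rest} → All (Incident q) inc → R ↭ inc ++ rest → 2 ≤ length inc →
          Trade es ⊎ ∃ λ unseen′ → Exploration unseen′ × length unseen ≡ suc (length unseen′)
        branch [] _ _ ()
        branch (_ ∷ []) _ _ (s≤s ())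
        branch (e ∷ f ∷ inc) {rest} (ie ∷ if ∷ _) π _ = continue (x ∈? seen) (y ∈? seen)
          where
          R′ = inc ++ rest
          x = proj₁ (incident⇒joins {e = e} ie)
          y = proj₁ (incident⇒joins {e = f} if)
          je = proj₂ (incident⇒joins {e = e} ie)
          jf = proj₂ (incident⇒joins {e = f} if)
          ends′ : All (EndsIn vs) (e ∷ f ∷ R′)
          ends′ = All-resp-↭ π R-ends

          continue : Dec (x ∈ seen) → Dec (y ∈ seen) →
            Trade es ⊎ ∃ λ unseen′ → Exploration unseen′ × length unseen ≡ suc (length unseen′)
          continue (no x∉) _ = inj₂ (extend π je (joins-endsIn {e} je (All.lookup ends′ (here refl))) x∉)
          continue (yes _) (no y∉) =
            inj₂ (extend (↭-trans π (swap e f refl)) jf (joins-endsIn {f} jf (All.lookup ends′ (there (here refl)))) y∉)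
          continue (yes x∈) (yes y∈)
            with (_ , σˣ) , xσ∈ , refl ← ∈-map⁻ proj₁ x∈ | (_ , σʸ) , yσ∈ , refl ← ∈-map⁻ proj₁ y∈ =
            inj₁ (comb-↭ (↭-sym (↭-trans split (↭-trans (++⁺ˡ U π) (++-comm U (e ∷ f ∷ R′)))))
                   (comb-↭ (prep e (prep f (++-comm U R′)))
                     (comb-pad (spanned-close je jf tree xσ∈ yσ∈))))
            where
            comb-pad : Trade (e ∷ f ∷ U) → Trade ((e ∷ f ∷ U) ++ R′)
            comb-pad t = comb-++ t (comb-zero R′)

      explore : ∀ n {unseen} → length unseen ≡ n → Exploration unseen → Trade es
      explore n len s with explore-step s
      ... | inj₁ t = t
      explore zero    len s | inj₂ (_ , _ , len′) with () ← ≡-trans (sym len) len′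
      explore (suc n) len s | inj₂ (_ , s′ , len′) = explore n (ℕP.suc-injective (≡-trans (sym len′) len)) s′

      dense⇒trade : ∀ {a} → a ∈ vs → Trade es
      dense⇒trade {a} a∈ = explore (length vs) refl record
        { q = a
        ; σ = +
        ; ts = []
        ; U = []
        ; q∈vs = a∈
        ; split = refl
        ; tree = λ where (here refl) (here refl) → false , comb-resp (λ z → ℤP.+-inverseʳ (δ a z)) (comb-zero [])
        ; closed = []
        ; last = z≤n
        ; cover = inj₂
        }

    -- The edge bound by vertex elimination

    names : List (V × Bool) → List V
    names = map proj₁

    loops : List (V × Bool) → List (Edge V)
    loops = map (loop ∘ proj₁) ∘ filter (λ v → proj₂ v BoolP.≟ true)

    loops-↭ : ∀ {vs ws} → vs ↭ ws → loops vs ↭ loops ws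
    loops-↭ π = map⁺ (loop ∘ proj₁) (filter-↭ (λ v → proj₂ v BoolP.≟ true) π)

    -- Every edge costs three units. Three units of a vertex pay for a tree edge; the fourth is its
    -- share in the extra edge of an odd cycle, which has at least three vertices to share it. A
    -- flagged vertex has spent its fourth unit.
    capacity : V × Bool → ℕ
    capacity (_ , flagged) = if flagged then 3 else 4

    -- A flagged vertex x stands for an odd cycle through x, that is, for a loop 2 δ x; an edge weight counts
    -- the vertices eliminated inside the path it stands for.
    Sparse : List (V × Bool) → List (Edge V) → Set
    Sparse vs es = 3 ℕ.* length es ℕ.+ 3 ≤ sum (map capacity vs) ℕ.+ sum (map weight es)

    Result : List (V × Bool) → List (Edge V) → Set
    Result vs es = Trade (loops vs ++ es) ⊎ Sparse vs es

    result-↭ : ∀ {vs ws es fs} → vs ↭ ws → es ↭ fs → Result vs es → Result ws fs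
    result-↭ {ws = ws} {es = es} π ρ (inj₁ t) = inj₁ (comb-↭ (↭-trans (++⁺ʳ es (loops-↭ π)) (++⁺ˡ (loops ws) ρ)) t)
    result-↭ π ρ (inj₂ h) rewrite ↭-length ρ | sum-↭ (map⁺ capacity π) | sum-↭ (map⁺ weight ρ) = inj₂ h

    -- True of every merged edge: it has passed through a flagged vertex and is free, or through an
    -- unflagged one and has positive weight.
    Heavy : Edge V → Set
    Heavy e = kind e ≡ any ⊎ 1 ≤ weight e

    Parallel : Edge V → Edge V → Set
    Parallel e f = ∃₂ λ a x → Joins e a x × Joins f a x

    -- What survives of simplicity under merging: two edges that are not heavy are never parallel.
    -- It ensures that an odd cycle is charged to at least three vertices.
    Apart : Edge V → Edge V → Set
    Apart e f = Heavy e ⊎ Heavy f ⊎ ¬ Parallel e f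

    apart-sym : Symmetric Apart
    apart-sym (inj₁ h)        = inj₂ (inj₁ h)
    apart-sym (inj₂ (inj₁ h)) = inj₁ h
    apart-sym (inj₂ (inj₂ n)) = inj₂ (inj₂ λ (a , x , je , jf) → n (a , x , jf , je))

    Proper : List V → Edge V → Set
    Proper vs e = src e ≢ dst e × EndsIn vs e

    proper-tail : ∀ {a vs e} → ¬ Incident a e → Proper (a ∷ vs) e → Proper vs e
    proper-tail ¬i (s≢d , here refl , _)       = ⊥-elim (¬i (inj₁ refl))
    proper-tail ¬i (s≢d , there _ , here refl) = ⊥-elim (¬i (inj₂ refl))
    proper-tail ¬i (s≢d , there s∈ , there d∈) = s≢d , s∈ , d∈

    proper-tails : ∀ {a vs es} → All (¬_ ∘ Incident a) es → All (Proper (a ∷ vs)) es → All (Proper vs) es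
    proper-tails []             []             = []
    proper-tails {es = e ∷ _} (¬i ∷ ¬is) (p ∷ ps) = proper-tail {e = e} ¬i p ∷ proper-tails ¬is ps

    proper-neighbour : ∀ {a x vs e} → Joins e a x → Proper (a ∷ vs) e → x ∈ vs
    proper-neighbour (inj₁ (refl , refl)) (s≢d , _ , here refl) = ⊥-elim (s≢d refl)
    proper-neighbour (inj₁ (refl , refl)) (s≢d , _ , there x∈)  = x∈
    proper-neighbour (inj₂ (refl , refl)) (s≢d , here refl , _) = ⊥-elim (s≢d refl)
    proper-neighbour (inj₂ (refl , refl)) (s≢d , there x∈ , _)  = x∈

    pathKind : Bool → Kind → Kind → Kind
    pathKind flagged κ κ′ = if flagged then any else mergeKind κ κ′

    -- Merging at a vertex loses one edge, worth 3 units. An unflagged vertex frees 4, and the spare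
    -- unit is stored as weight; a flagged one frees exactly 3.
    pathWeight : Bool → ℕ → ℕ → ℕ
    pathWeight flagged w w′ = if flagged then w ℕ.+ w′ else suc (w ℕ.+ w′)

    path-heavy : ∀ flagged {x y κ κ′ w w′} → Heavy (edge x y (pathKind flagged κ κ′) (pathWeight flagged w w′))
    path-heavy true  = inj₁ refl
    path-heavy false = inj₂ (s≤s z≤n)

    eliminate-vertex : ∀ flagged {e f a x y w vs es nz b} → Joins e a x → Joins f a y →
      Comb (edge x y (pathKind flagged (kind e) (kind f)) w ∷ loops vs ++ es) nz b →
      Comb (loops ((a , flagged) ∷ vs) ++ e ∷ f ∷ es) nz b
    eliminate-vertex false {e} {f} {vs = vs} je jf c =
      comb-↭ (shifts (e ∷ f ∷ []) (loops vs)) (eliminate je jf c)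
    eliminate-vertex true {e} {f} {a} {vs = vs} je jf c =
      comb-↭ (shifts (e ∷ f ∷ []) (loop a ∷ loops vs)) (eliminate-flagged je jf c)

    -- An edge from x to itself of sign - is a closed even cycle: δ x - δ x = 0.
    even-loop : ∀ {x κ w} es → Allows κ - → Trade (edge x x κ w ∷ es)
    even-loop {x} es al = take + al (comb-zero es) λ p → eq (δ x p)
      where
      eq : ∀ a → 0ℤ ≡ (a ℤ.+ ℤ.- a) ℤ.+ 0ℤ
      eq = solve 1 (λ a → con 0ℤ := (a :+ (:- a)) :+ con 0ℤ) refl

    -- Two odd cycles meeting in x cancel: 2 δ x - 2 δ x = 0.
    two-loops : ∀ {x w} es → Trade (edge x x (fix +) w ∷ loop x ∷ es)
    two-loops {x} es = take + fixed (take - fixed (comb-zero es) λ _ → refl) λ p → eq (δ x p)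
      where
      eq : ∀ a → 0ℤ ≡ (a ℤ.+ a) ℤ.+ (ℤ.- (a ℤ.+ a) ℤ.+ 0ℤ)
      eq = solve 1 (λ a → con 0ℤ := (a :+ a) :+ (:- (a :+ a) :+ con 0ℤ)) refl

    mergeKind-fix : ∀ κ κ′ {ρ} → mergeKind κ κ′ ≡ fix ρ → κ ≢ any × κ′ ≢ any
    mergeKind-fix (fix _) (fix _) _ = (λ ()) , λ ()

    -- Induction on the vertices: at a vertex of degree at most 2 the edges are merged into one and the vertex
    -- disappears; if all degrees are at least 3, the greedy exploration above finds a dependency.
    Bound : ℕ → Set
    Bound n = ∀ vs es → length vs ≡ suc n → Unique (names vs) →
      All (Proper (names vs)) es → AllPairs Apart es → Result vs es

    3≤capacity : ∀ v → 3 ≤ capacity v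
    3≤capacity (_ , true)  = s≤s (s≤s (s≤s z≤n))
    3≤capacity (_ , false) = s≤s (s≤s (s≤s z≤n))

    prune : ∀ v vs {es} → Trade (loops vs ++ es) → Trade (loops (v ∷ vs) ++ es)
    prune (_ , true)  _ t = skip t
    prune (_ , false) _ t = t

    weigh-path : ∀ flagged l c w w₁ w₂ →
      3 ℕ.* suc l ℕ.+ 3 ≤ c ℕ.+ (pathWeight flagged w₁ w₂ ℕ.+ w) →
      3 ℕ.* suc (suc l) ℕ.+ 3 ≤ ((if flagged then 3 else 4) ℕ.+ c) ℕ.+ (w₁ ℕ.+ (w₂ ℕ.+ w))
    weigh-path true l c w w₁ w₂ h = begin
      3 ℕ.* suc (suc l) ℕ.+ 3             ≡⟨ lhs l ⟩
      3 ℕ.+ (3 ℕ.* suc l ℕ.+ 3)           ≤⟨ ℕP.+-monoʳ-≤ 3 h ⟩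
      3 ℕ.+ (c ℕ.+ (w₁ ℕ.+ w₂ ℕ.+ w))     ≡⟨ rhs c w w₁ w₂ ⟩
      3 ℕ.+ c ℕ.+ (w₁ ℕ.+ (w₂ ℕ.+ w))     ∎
      where
      open ℕP.≤-Reasoning
      lhs : ∀ l → 3 ℕ.* suc (suc l) ℕ.+ 3 ≡ 3 ℕ.+ (3 ℕ.* suc l ℕ.+ 3)
      lhs = ℕSolver.solve-∀
      rhs : ∀ c w w₁ w₂ → 3 ℕ.+ (c ℕ.+ (w₁ ℕ.+ w₂ ℕ.+ w)) ≡ 3 ℕ.+ c ℕ.+ (w₁ ℕ.+ (w₂ ℕ.+ w))
      rhs = ℕSolver.solve-∀
    weigh-path false l c w w₁ w₂ h = begin
      3 ℕ.* suc (suc l) ℕ.+ 3                 ≡⟨ lhs l ⟩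
      3 ℕ.+ (3 ℕ.* suc l ℕ.+ 3)               ≤⟨ ℕP.+-monoʳ-≤ 3 h ⟩
      3 ℕ.+ (c ℕ.+ (suc (w₁ ℕ.+ w₂) ℕ.+ w))   ≡⟨ rhs c w w₁ w₂ ⟩
      4 ℕ.+ c ℕ.+ (w₁ ℕ.+ (w₂ ℕ.+ w))         ∎
      where
      open ℕP.≤-Reasoning
      lhs : ∀ l → 3 ℕ.* suc (suc l) ℕ.+ 3 ≡ 3 ℕ.+ (3 ℕ.* suc l ℕ.+ 3)
      lhs = ℕSolver.solve-∀
      rhs : ∀ c w w₁ w₂ → 3 ℕ.+ (c ℕ.+ (1 ℕ.+ (w₁ ℕ.+ w₂) ℕ.+ w)) ≡ 4 ℕ.+ c ℕ.+ (w₁ ℕ.+ (w₂ ℕ.+ w))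
      rhs = ℕSolver.solve-∀

    -- Two edges vanish, worth 6 units. Deleting one vertex and flagging the other frees 4 + 4 - 3 =
    -- 5; the sixth unit comes from a vertex inside the two edges, the third vertex of the cycle.
    weigh-digon : ∀ l c w w₁ w₂ → 1 ≤ w₁ ℕ.+ w₂ → 3 ℕ.* l ℕ.+ 3 ≤ (3 ℕ.+ c) ℕ.+ w →
      3 ℕ.* suc (suc l) ℕ.+ 3 ≤ (4 ℕ.+ (4 ℕ.+ c)) ℕ.+ (w₁ ℕ.+ (w₂ ℕ.+ w))
    weigh-digon l c w w₁ w₂ h₁ h = begin
      3 ℕ.* suc (suc l) ℕ.+ 3                 ≡⟨ lhs l ⟩
      6 ℕ.+ (3 ℕ.* l ℕ.+ 3)                   ≤⟨ ℕP.+-monoʳ-≤ 6 h ⟩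
      6 ℕ.+ (3 ℕ.+ c ℕ.+ w)                   ≡⟨ mid c w ⟩
      8 ℕ.+ c ℕ.+ w ℕ.+ 1                     ≤⟨ ℕP.+-monoʳ-≤ (8 ℕ.+ c ℕ.+ w) h₁ ⟩
      8 ℕ.+ c ℕ.+ w ℕ.+ (w₁ ℕ.+ w₂)           ≡⟨ rhs c w w₁ w₂ ⟩
      (4 ℕ.+ (4 ℕ.+ c)) ℕ.+ (w₁ ℕ.+ (w₂ ℕ.+ w)) ∎
      where
      open ℕP.≤-Reasoning
      lhs : ∀ l → 3 ℕ.* suc (suc l) ℕ.+ 3 ≡ 6 ℕ.+ (3 ℕ.* l ℕ.+ 3)
      lhs = ℕSolver.solve-∀
      mid : ∀ c w → 6 ℕ.+ (3 ℕ.+ c ℕ.+ w) ≡ 8 ℕ.+ c ℕ.+ w ℕ.+ 1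
      mid = ℕSolver.solve-∀
      rhs : ∀ c w w₁ w₂ → 8 ℕ.+ c ℕ.+ w ℕ.+ (w₁ ℕ.+ w₂) ≡ (4 ℕ.+ (4 ℕ.+ c)) ℕ.+ (w₁ ℕ.+ (w₂ ℕ.+ w))
      rhs = ℕSolver.solve-∀

    module _ {n} (ih : Bound n) {a} (flagged : Bool) (vs : List (V × Bool)) (len : length vs ≡ suc n)
             (a-unique : Unique (a ∷ names vs)) where

      unique : Unique (names vs)
      unique = AllPairs.tail a-unique

      bound-low : ∀ inc rest → All (Incident a) inc → All (¬_ ∘ Incident a) rest → length inc ≤ 2 →
        All (Proper (a ∷ names vs)) (inc ++ rest) → AllPairs Apart (inc ++ rest) →
        Result ((a , flagged) ∷ vs) (inc ++ rest)
      bound-low [] rest _ ¬inc _ proper apart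
        with ih vs rest len unique (proper-tails ¬inc proper) apart
      ... | inj₁ t = inj₁ (prune (a , flagged) vs t)
      ... | inj₂ h = inj₂ (ℕP.≤-trans h (ℕP.+-monoˡ-≤ (sum (map weight rest)) (ℕP.m≤n+m _ (capacity (a , flagged)))))
      bound-low (e ∷ []) rest _ ¬inc _ (_ ∷ proper) (_ ∷ apart)
        with ih vs rest len unique (proper-tails ¬inc proper) apart
      ... | inj₁ t = inj₁ (prune (a , flagged) vs (comb-↭ (↭-sym (shift e (loops vs) rest)) (skip t)))
      ... | inj₂ h = inj₂ (begin
        3 ℕ.* suc (length rest) ℕ.+ 3   ≡⟨ eq (length rest) ⟩
        3 ℕ.+ (3 ℕ.* length rest ℕ.+ 3) ≤⟨ ℕP.+-mono-≤ (3≤capacity (a , flagged)) h ⟩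
        c ℕ.+ (C ℕ.+ W)                 ≡⟨ ℕP.+-assoc c C W ⟨
        c ℕ.+ C ℕ.+ W                   ≤⟨ ℕP.+-monoʳ-≤ (c ℕ.+ C) (ℕP.m≤n+m W (weight e)) ⟩
        c ℕ.+ C ℕ.+ (weight e ℕ.+ W)    ∎)
        where
        open ℕP.≤-Reasoning
        c = capacity (a , flagged)
        C = sum (map capacity vs)
        W = sum (map weight rest)
        eq : ∀ l → 3 ℕ.* suc l ℕ.+ 3 ≡ 3 ℕ.+ (3 ℕ.* l ℕ.+ 3)
        eq = ℕSolver.solve-∀
      bound-low (e ∷ f ∷ []) rest (ie ∷ if ∷ []) ¬inc _ (pe ∷ pf ∷ proper) ((ef ∷ _) ∷ _ ∷ apart)
        with incident⇒joins {e = e} ie | incident⇒joins {e = f} if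
      ... | x , je | y , jf with x ≟ y
      -- Distinct neighbours: `a` becomes an inner vertex of a single edge `g`, which is heavy and
      -- therefore `Apart` from all others.
      ... | no x≢y = path
        where
        g = edge x y (pathKind flagged (kind e) (kind f)) (pathWeight flagged (weight e) (weight f))

        path : Result ((a , flagged) ∷ vs) (e ∷ f ∷ rest)
        path with ih vs (g ∷ rest) len unique
                    ((x≢y , proper-neighbour {e = e} je pe , proper-neighbour {e = f} jf pf) ∷
                      proper-tails ¬inc proper)
                    (All.tabulate (λ _ → inj₁ (path-heavy flagged {x} {y} {kind e} {kind f} {weight e} {weight f})) ∷ apart)
        ... | inj₁ t = inj₁ (eliminate-vertex flagged {vs = vs} je jf (comb-↭ (shift g (loops vs) rest) t))
        ... | inj₂ h = inj₂ (weigh-path flagged (length rest) (sum (map capacity vs)) (sum (map weight rest)) (weight e) (weight f) h)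
      ... | yes refl = digon flagged refl
        where
        digon : ∀ b → b ≡ flagged → Result ((a , flagged) ∷ vs) (e ∷ f ∷ rest)
        -- The loop at `a` makes the merged edge free, so it can be closed with sign -.
        digon true  refl = inj₁ (eliminate-vertex true {w = 0} {vs} je jf (even-loop (loops vs ++ rest) free))
        digon false refl with mergeKind (kind e) (kind f) in κ
        ... | any   = inj₁ (eliminate-vertex false {w = 0} {vs} je jf
                        (subst (λ κ → Trade (edge x x κ 0 ∷ loops vs ++ rest)) (sym κ) (even-loop (loops vs ++ rest) free)))
        ... | fix - = inj₁ (eliminate-vertex false {w = 0} {vs} je jf
                        (subst (λ κ → Trade (edge x x κ 0 ∷ loops vs ++ rest)) (sym κ) (even-loop (loops vs ++ rest) fixed)))
        -- The digon is an odd cycle. If `x` is flagged, two odd cycles meet in `x`; otherwise `a`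
        -- is deleted together with both edges and `x` becomes flagged.
        ... | fix + with ∈-map⁻ proj₁ (proper-neighbour {e = e} je pe)
        ...   | (_ , true) , xb∈ , refl with ws , π ← ∈-↭ xb∈ = inj₁ (eliminate-vertex false {w = 0} {vs} je jf
                  (subst (λ κ → Trade (edge x x κ 0 ∷ loops vs ++ rest)) (sym κ)
                    (comb-↭ (prep _ (++⁺ʳ rest (loops-↭ (↭-sym π)))) (two-loops (loops ws ++ rest)))))
        ...   | (_ , false) , xb∈ , refl with ws , π ← ∈-↭ xb∈
                  with ih ((x , true) ∷ ws) rest (≡-trans (sym (↭-length π)) len)
                         (unique-↭ (map⁺ proj₁ π) unique)
                         (proper-tails ¬inc (All.map (λ (s≢d , s∈ , d∈) → s≢d , mv s∈ , mv d∈) proper))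
                         apart
                  where
                  mv : ∀ {z} → z ∈ a ∷ names vs → z ∈ a ∷ x ∷ names ws
                  mv = ∈-resp-↭ (prep a (map⁺ proj₁ π))
        ...   | inj₁ t = inj₁ (eliminate-vertex false {w = 0} {vs} je jf
                    (subst (λ κ → Trade (edge x x κ 0 ∷ loops vs ++ rest)) (sym κ)
                      (comb-↭ (prep _ (++⁺ʳ rest (loops-↭ (↭-sym π)))) (reloop t))))
                  where
                  reloop : ∀ {fs nz c w} → Comb (loop x ∷ fs) nz c → Comb (edge x x (fix +) w ∷ fs) nz c
                  reloop (skip c)        = skip c
                  reloop (take ε al c q) = take ε al c q
        ...   | inj₂ h rewrite sum-↭ (map⁺ capacity π) = inj₂
                    (weigh-digon (length rest) (sum (map capacity ws)) (sum (map weight rest)) (weight e) (weight f)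
                      (light ef) h)
                  where
                  light : Apart e f → 1 ≤ weight e ℕ.+ weight f
                  -- Both kinds are fixed, as the merged kind is `fix +`; a heavy edge among the two
                  -- must then have positive weight.
                  light (inj₁ (inj₁ k))        = ⊥-elim (proj₁ (mergeKind-fix (kind e) (kind f) κ) k)
                  light (inj₁ (inj₂ h))        = ℕP.≤-trans h (ℕP.m≤m+n (weight e) (weight f))
                  light (inj₂ (inj₁ (inj₁ k))) = ⊥-elim (proj₂ (mergeKind-fix (kind e) (kind f) κ) k)
                  light (inj₂ (inj₁ (inj₂ h))) = ℕP.≤-trans h (ℕP.m≤n+m (weight f) (weight e))
                  light (inj₂ (inj₂ ¬par))     = ⊥-elim (¬par (a , x , je , jf))
      bound-low (_ ∷ _ ∷ _ ∷ _) _ _ _ (s≤s (s≤s ()))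

    find-low : ∀ vs es → (∃₂ λ a b → ∃ λ ws → vs ↭ (a , b) ∷ ws × degree a es ≤ 2) ⊎
                         (∀ {a} → a ∈ names vs → 3 ≤ degree a es)
    find-low [] es = inj₂ λ ()
    find-low ((a , b) ∷ vs) es with degree a es ℕ.≤? 2
    ... | yes low = inj₁ (a , b , vs , refl , low)
    ... | no high with find-low vs es
    ...   | inj₁ (c , d , ws , π , low) =
              inj₁ (c , d , (a , b) ∷ ws , ↭-trans (prep (a , b) π) (swap (a , b) (c , d) refl) , low)
    ...   | inj₂ dense = inj₂ λ where
              (here refl) → ℕP.≰⇒> high
              (there a∈)  → dense a∈

    bound : ∀ n → Bound n
    -- A tree has one edge fewer than vertices: this is the summand 3 in `Sparse`, and even a
    -- flagged vertex can pay it.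
    bound zero ((x , b) ∷ []) [] _ _ _ _ with b
    ... | true  = inj₂ (s≤s (s≤s (s≤s z≤n)))
    ... | false = inj₂ (s≤s (s≤s (s≤s z≤n)))
    bound zero ((x , b) ∷ []) (e ∷ es) _ _ ((s≢d , here p , here q) ∷ _) _ = ⊥-elim (s≢d (≡-trans p (sym q)))
    bound (suc n) vs@(_ ∷ _) es len unique proper apart with find-low vs es
    ... | inj₂ dense = inj₁ (comb-skips (loops vs) (dense⇒trade (All.map proj₂ proper) dense (here refl)))
    ... | inj₁ (a , b , ws , π , low) =
      result-↭ (↭-sym π) (↭-sym ρ)
        (bound-low (bound n) b ws (ℕP.suc-injective (≡-trans (sym (↭-length π)) len))
          (unique-↭ (map⁺ proj₁ π) unique) (star a es) (filter (¬? ∘ incident? a) es)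
          (all-filter (incident? a) es) (all-filter (¬? ∘ incident? a) es) low
          (All-resp-↭ ρ (All.map (λ (s≢d , s∈ , d∈) → s≢d , mv s∈ , mv d∈) proper)) (allPairs-↭ apart-sym ρ apart))
      where
      ρ = filter-split (incident? a) es
      mv : ∀ {z} → z ∈ names vs → z ∈ a ∷ names ws
      mv = ∈-resp-↭ (map⁺ proj₁ π)

open SignedGraphs

open import Data.Bool using (Bool; true; false; _∧_; _∨_; not; if_then_else_; T)
import Data.Bool.Properties as BoolP
open import Data.Bool.Properties using (T?; T-≡)
open import Data.Empty using (⊥; ⊥-elim)
open import Data.Fin using (Fin; zero; suc)
import Data.Fin.Properties as FinP
open import Data.Fin.Subset using (inside; outside; ∣_∣; _∪_; ∁; ⁅_⁆; ⊤) renaming (⊥ to ⊥ˢ)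
open import Data.Fin.Subset.Properties
  using (_∈?_; ∣⁅x⁆∣≡1; ∣∁p∣≡n∸∣p∣; ∣⊤∣≡n; ∪-comm; ∪-assoc)
open import Data.Integer as ℤ using (ℤ)
import Data.Integer.Properties as ℤP
import Data.Integer.Tactic.RingSolver as ℤSolver
open import Data.List using ([]; _∷_; _++_; map; filter; allFin)
open import Data.List.Membership.Propositional using (_∈_; _∉_)
open import Data.List.Membership.Propositional.Properties
  using (∈-map⁺; ∈-map⁻; ∈-++⁺ˡ; ∈-++⁺ʳ; ∈-++⁻; ∈-filter⁺; ∈-filter⁻)
import Data.List.Membership.DecPropositional as DecMembership
open import Data.List.Properties using (length-map; map-tabulate)
open import Data.List.Relation.Binary.Disjoint.Propositional using (Disjoint)
open import Data.List.Relation.Unary.All as All using (All; []; _∷_)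
import Data.List.Relation.Unary.All.Properties as AllP
open import Data.List.Relation.Unary.All.Properties using (all-filter)
open import Data.List.Relation.Unary.AllPairs using (AllPairs; []; _∷_)
open import Data.List.Relation.Unary.Any using (here; there)
open import Data.List.Relation.Unary.Unique.Propositional using (Unique)
open import Data.List.Relation.Unary.Unique.Propositional.Properties using (map⁺; ++⁺; filter⁺)
open import Data.Nat
open import Data.Nat.Combinatorics using (_C_; nC1≡n; nCk+nC[k+1]≡[n+1]C[k+1])
open import Data.Nat.ListAction using (sum)
open import Data.Nat.Properties hiding (_≟_)
open import Data.Nat.Tactic.RingSolver using (solve-∀)
open import Data.Product using (∃; ∃₂; _×_; _,_; proj₁; proj₂)
open import Data.Sign as Sign using (Sign)
open import Data.Sum using (_⊎_; inj₁; inj₂; [_,_]′)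
open import Data.Vec using ([]; _∷_; head; tail; lookup)
open import Data.Vec.Properties using (≡-dec)
import Data.Vec.Properties as VecP
open import Function using (_∘_)
open import Function.Bundles using (Equivalence)
open import Relation.Binary.PropositionalEquality
open import Relation.Nullary
open import Relation.Nullary.Decidable using (_×-dec_; ¬?)
open import Relation.Unary using (Decidable)

-- Sums over subsets

𝟙 : Bool → ℕ
𝟙 b = if b then 1 else 0

𝟙-∧ : ∀ a b → 𝟙 (a ∧ b) ≡ 𝟙 a * 𝟙 b
𝟙-∧ true  b = sym (+-identityʳ (𝟙 b))
𝟙-∧ false b = refl

∑ : ∀ {A : Set} → List A → (A → ℕ) → ℕ
∑ []       f = 0
∑ (x ∷ xs) f = f x + ∑ xs f

syntax ∑ xs (λ x → e) = ∑[ x ← xs ] e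

module _ {A : Set} where

  ∑-cong : ∀ (xs : List A) {f g} → (∀ x → f x ≡ g x) → ∑ xs f ≡ ∑ xs g
  ∑-cong []       eq = refl
  ∑-cong (x ∷ xs) eq = cong₂ _+_ (eq x) (∑-cong xs eq)

  ∑-mono : ∀ (xs : List A) {f g} → (∀ x → f x ≤ g x) → ∑ xs f ≤ ∑ xs g
  ∑-mono []       le = z≤n
  ∑-mono (x ∷ xs) le = +-mono-≤ (le x) (∑-mono xs le)

  ∑-zero : ∀ (xs : List A) → ∑ xs (λ _ → 0) ≡ 0
  ∑-zero []       = refl
  ∑-zero (x ∷ xs) = ∑-zero xs

  ∑-+ : ∀ (xs : List A) f g → ∑[ x ← xs ] (f x + g x) ≡ ∑ xs f + ∑ xs g
  ∑-+ []       f g = refl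
  ∑-+ (x ∷ xs) f g = trans (cong (f x + g x +_) (∑-+ xs f g)) (eq (f x) (g x) (∑ xs f) (∑ xs g))
    where
    eq : ∀ a b c d → a + b + (c + d) ≡ a + c + (b + d)
    eq = solve-∀

  ∑-*ˡ : ∀ (xs : List A) c f → ∑[ x ← xs ] (c * f x) ≡ c * ∑ xs f
  ∑-*ˡ []       c f = sym (*-zeroʳ c)
  ∑-*ˡ (x ∷ xs) c f = trans (cong (c * f x +_) (∑-*ˡ xs c f)) (sym (*-distribˡ-+ c (f x) (∑ xs f)))

  ∑-*ʳ : ∀ (xs : List A) c f → ∑[ x ← xs ] (f x * c) ≡ ∑ xs f * c
  ∑-*ʳ xs c f = trans (∑-cong xs λ x → *-comm (f x) c) (trans (∑-*ˡ xs c f) (*-comm c (∑ xs f)))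

  ∑-++ : ∀ (xs ys : List A) f → ∑ (xs ++ ys) f ≡ ∑ xs f + ∑ ys f
  ∑-++ []       ys f = refl
  ∑-++ (x ∷ xs) ys f = trans (cong (f x +_) (∑-++ xs ys f)) (sym (+-assoc (f x) (∑ xs f) (∑ ys f)))

  ∑-map : ∀ {B : Set} (h : B → A) ys f → ∑ (map h ys) f ≡ ∑ ys (f ∘ h)
  ∑-map h []       f = refl
  ∑-map h (y ∷ ys) f = cong (f (h y) +_) (∑-map h ys f)

  ∑-filter : ∀ {P : A → Set} (P? : Decidable P) xs f →
             ∑ (filter P? xs) f ≡ ∑[ x ← xs ] (𝟙 (does (P? x)) * f x)
  ∑-filter P? []       f = refl
  ∑-filter P? (x ∷ xs) f with does (P? x)
  ... | true  = cong₂ _+_ (sym (+-identityʳ (f x))) (∑-filter P? xs f)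
  ... | false = ∑-filter P? xs f

  ∑-one : ∀ (xs : List A) → ∑ xs (λ _ → 1) ≡ length xs
  ∑-one []       = refl
  ∑-one (x ∷ xs) = cong suc (∑-one xs)

∑-swap : ∀ {A B : Set} (xs : List A) (ys : List B) (f : A → B → ℕ) →
         ∑[ x ← xs ] ∑[ y ← ys ] f x y ≡ ∑[ y ← ys ] ∑[ x ← xs ] f x y
∑-swap []       ys f = sym (∑-zero ys)
∑-swap (x ∷ xs) ys f = trans (cong (∑ ys (f x) +_) (∑-swap xs ys f))
  (sym (∑-+ ys (f x) (λ y → ∑[ x ← xs ] f x y)))

2ab≤a²+b² : ∀ a b → 2 * (a * b) ≤ a * a + b * b
2ab≤a²+b² a b with ≤-total a b
... | inj₁ a≤b rewrite sym (m+[n∸m]≡n a≤b) = ordered a (b ∸ a)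
  where
  ordered : ∀ a c → 2 * (a * (a + c)) ≤ a * a + (a + c) * (a + c)
  ordered a c = subst (2 * (a * (a + c)) ≤_) (eq a c) (m≤m+n _ (c * c))
    where
    eq : ∀ a c → 2 * (a * (a + c)) + c * c ≡ a * a + (a + c) * (a + c)
    eq = solve-∀
... | inj₂ b≤a rewrite sym (m+[n∸m]≡n b≤a) = ordered b (a ∸ b)
  where
  ordered : ∀ b c → 2 * ((b + c) * b) ≤ (b + c) * (b + c) + b * b
  ordered b c = subst (2 * ((b + c) * b) ≤_) (eq b c) (m≤m+n _ (c * c))
    where
    eq : ∀ b c → 2 * ((b + c) * b) + c * c ≡ (b + c) * (b + c) + b * b
    eq = solve-∀

∑-product : ∀ {A B : Set} (xs : List A) (ys : List B) (f : A → ℕ) (g : B → ℕ) →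
            ∑[ x ← xs ] ∑[ y ← ys ] (f x * g y) ≡ ∑ xs f * ∑ ys g
∑-product xs ys f g = trans (∑-cong xs λ x → ∑-*ˡ ys (f x) g) (∑-*ʳ xs (∑ ys g) f)

-- Doubled, both sides are double sums that compare termwise by 2 a b ≤ a² + b²; no subtraction
-- occurs.
cauchy-schwarz : ∀ {A : Set} (xs : List A) (w f : A → ℕ) →
  ∑[ x ← xs ] (w x * f x) * ∑[ x ← xs ] (w x * f x) ≤ ∑ xs w * ∑[ x ← xs ] (w x * (f x * f x))
cauchy-schwarz xs w f = *-cancelˡ-≤ 2 (begin
  2 * (S * S)                                                   ≡⟨ cong (2 *_) (∑-product xs xs (λ x → w x * f x) (λ x → w x * f x)) ⟨
  2 * ∑[ x ← xs ] ∑[ y ← xs ] (w x * f x * (w y * f y))         ≡⟨ ∑-*ˡ xs 2 _ ⟨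
  ∑[ x ← xs ] (2 * ∑[ y ← xs ] (w x * f x * (w y * f y)))       ≡⟨ ∑-cong xs (λ x → ∑-*ˡ xs 2 _) ⟨
  ∑[ x ← xs ] ∑[ y ← xs ] (2 * (w x * f x * (w y * f y)))       ≤⟨ ∑-mono xs (λ x → ∑-mono xs (pointwise x)) ⟩
  ∑[ x ← xs ] ∑[ y ← xs ] (q x * w y + w x * q y)               ≡⟨ ∑-cong xs (λ x → ∑-+ xs (λ y → q x * w y) (λ y → w x * q y)) ⟩
  ∑[ x ← xs ] (∑[ y ← xs ] (q x * w y) + ∑[ y ← xs ] (w x * q y)) ≡⟨ ∑-+ xs _ _ ⟩
  ∑[ x ← xs ] ∑[ y ← xs ] (q x * w y) + ∑[ x ← xs ] ∑[ y ← xs ] (w x * q y)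
    ≡⟨ cong₂ _+_ (∑-product xs xs q w) (∑-product xs xs w q) ⟩
  Q * W + W * Q                                                 ≡⟨ eq Q W ⟩
  2 * (W * Q)                                                   ∎)
  where
  open ≤-Reasoning
  q : _ → ℕ
  q x = w x * (f x * f x)
  S = ∑[ x ← xs ] (w x * f x)
  W = ∑ xs w
  Q = ∑ xs q
  eq : ∀ a b → a * b + b * a ≡ 2 * (b * a)
  eq = solve-∀
  pointwise : ∀ x y → 2 * (w x * f x * (w y * f y)) ≤ q x * w y + w x * q y
  pointwise x y = begin
    2 * (w x * f x * (w y * f y))                      ≡⟨ lhs (w x) (f x) (w y) (f y) ⟩
    w x * w y * (2 * (f x * f y))                      ≤⟨ *-monoʳ-≤ (w x * w y) (2ab≤a²+b² (f x) (f y)) ⟩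
    w x * w y * (f x * f x + f y * f y)                ≡⟨ rhs (w x) (f x) (w y) (f y) ⟩
    q x * w y + w x * q y                              ∎
    where
    lhs : ∀ a b c d → 2 * (a * b * (c * d)) ≡ a * c * (2 * (b * d))
    lhs = solve-∀
    rhs : ∀ a b c d → a * c * (b * b + d * d) ≡ a * (b * b) * c + a * (c * (d * d))
    rhs = solve-∀

subsets : ∀ n → List (Subset n)
subsets zero    = [] ∷ []
subsets (suc n) = map (outside ∷_) (subsets n) ++ map (inside ∷_) (subsets n)

∑-subsets : ∀ n (f : Subset (suc n) → ℕ) →
  ∑ (subsets (suc n)) f ≡ ∑ (subsets n) (f ∘ (outside ∷_)) + ∑ (subsets n) (f ∘ (inside ∷_))
∑-subsets n f = trans (∑-++ (map (outside ∷_) (subsets n)) _ f)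
  (cong₂ _+_ (∑-map (outside ∷_) (subsets n) f) (∑-map (inside ∷_) (subsets n) f))

infix 4 _⊆ᵇ_ _⟂_

_⊆ᵇ_ : ∀ {n} → Subset n → Subset n → Bool
[]            ⊆ᵇ []      = true
(outside ∷ q) ⊆ᵇ (_ ∷ s) = q ⊆ᵇ s
(inside ∷ q)  ⊆ᵇ (b ∷ s) = b ∧ (q ⊆ᵇ s)

_⟂_ : ∀ {n} → Subset n → Subset n → Bool
[]            ⟂ []      = true
(outside ∷ q) ⟂ (_ ∷ s) = q ⟂ s
(inside ∷ q)  ⟂ (b ∷ s) = not b ∧ (q ⟂ s)

size : ∀ {n} → ℕ → Subset n → ℕ
size j s = 𝟙 (∣ s ∣ ≡ᵇ j)

-- Change of variable s = q ∪ t.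
∑-supersets : ∀ {n} (q : Subset n) (g : Subset n → ℕ) →
  ∑[ s ← subsets n ] (𝟙 (q ⊆ᵇ s) * g s) ≡ ∑[ t ← subsets n ] (𝟙 (q ⟂ t) * g (q ∪ t))
∑-supersets [] g = refl
∑-supersets {suc n} (outside ∷ q) g = trans (∑-subsets n _)
  (trans (cong₂ _+_ (∑-supersets q (g ∘ (outside ∷_))) (∑-supersets q (g ∘ (inside ∷_)))) (sym (∑-subsets n _)))
∑-supersets {suc n} (inside ∷ q) g = begin
  ∑[ s ← subsets (suc n) ] (𝟙 ((inside ∷ q) ⊆ᵇ s) * g s)                   ≡⟨ ∑-subsets n _ ⟩
  ∑ (subsets n) (λ _ → 0) + ∑[ s ← subsets n ] (𝟙 (q ⊆ᵇ s) * g (inside ∷ s)) ≡⟨ cong₂ _+_ (∑-zero (subsets n)) (∑-supersets q (g ∘ (inside ∷_))) ⟩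
  ∑[ t ← subsets n ] (𝟙 (q ⟂ t) * g (inside ∷ (q ∪ t)))                     ≡⟨ +-identityʳ _ ⟨
  ∑[ t ← subsets n ] (𝟙 (q ⟂ t) * g (inside ∷ (q ∪ t))) + 0                 ≡⟨ cong (∑[ t ← subsets n ] (𝟙 (q ⟂ t) * g (inside ∷ (q ∪ t))) +_) (∑-zero (subsets n)) ⟨
  ∑[ t ← subsets n ] (𝟙 (q ⟂ t) * g (inside ∷ (q ∪ t))) + ∑ (subsets n) (λ _ → 0) ≡⟨ ∑-subsets n _ ⟨
  ∑[ t ← subsets (suc n) ] (𝟙 ((inside ∷ q) ⟂ t) * g ((inside ∷ q) ∪ t))    ∎
  where open ≡-Reasoning

count-subsets : ∀ {n} (p : Subset n) j → ∑[ q ← subsets n ] (𝟙 (q ⊆ᵇ p) * size j q) ≡ ∣ p ∣ C j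
count-subsets [] zero    = refl
count-subsets [] (suc j) = refl
count-subsets {suc n} (outside ∷ p) j = trans (∑-subsets n _)
  (trans (cong₂ _+_ (count-subsets p j) (∑-zero (subsets n))) (+-identityʳ (∣ p ∣ C j)))
count-subsets {suc n} (inside ∷ p) zero = trans (∑-subsets n _)
  (trans (cong₂ _+_ (count-subsets p 0) (trans (∑-cong (subsets n) λ q → *-zeroʳ (𝟙 (q ⊆ᵇ p))) (∑-zero (subsets n)))) refl)
count-subsets {suc n} (inside ∷ p) (suc j) = trans (∑-subsets n _)
  (trans (cong₂ _+_ (count-subsets p (suc j)) (count-subsets p j))
    (trans (+-comm (∣ p ∣ C suc j) (∣ p ∣ C j)) (nCk+nC[k+1]≡[n+1]C[k+1] ∣ p ∣ j)))

∣∪∣ : ∀ {n} (q t : Subset n) → (q ⟂ t) ≡ true → ∣ q ∪ t ∣ ≡ ∣ q ∣ + ∣ t ∣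
∣∪∣ []            []            _ = refl
∣∪∣ (outside ∷ q) (outside ∷ t) d = ∣∪∣ q t d
∣∪∣ (outside ∷ q) (inside ∷ t)  d = trans (cong suc (∣∪∣ q t d)) (sym (+-suc ∣ q ∣ ∣ t ∣))
∣∪∣ (inside ∷ q)  (outside ∷ t) d = cong suc (∣∪∣ q t d)

⟂-∁ : ∀ {n} (q t : Subset n) → (q ⟂ t) ≡ (t ⊆ᵇ ∁ q)
⟂-∁ []            []            = refl
⟂-∁ (outside ∷ q) (outside ∷ t) = ⟂-∁ q t
⟂-∁ (outside ∷ q) (inside ∷ t)  = ⟂-∁ q t
⟂-∁ (inside ∷ q)  (outside ∷ t) = ⟂-∁ q t
⟂-∁ (inside ∷ q)  (inside ∷ t)  = refl

⟂-sym : ∀ {n} (q t : Subset n) → (q ⟂ t) ≡ (t ⟂ q)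
⟂-sym []            []            = refl
⟂-sym (outside ∷ q) (outside ∷ t) = ⟂-sym q t
⟂-sym (outside ∷ q) (inside ∷ t)  = ⟂-sym q t
⟂-sym (inside ∷ q)  (outside ∷ t) = ⟂-sym q t
⟂-sym (inside ∷ q)  (inside ∷ t)  = refl

∪-⊆ᵇ : ∀ {n} (p q s : Subset n) → (p ∪ q ⊆ᵇ s) ≡ (p ⊆ᵇ s) ∧ (q ⊆ᵇ s)
∪-⊆ᵇ []            []            []      = refl
∪-⊆ᵇ (outside ∷ p) (outside ∷ q) (_ ∷ s) = ∪-⊆ᵇ p q s
∪-⊆ᵇ (outside ∷ p) (inside ∷ q)  (b ∷ s) rewrite ∪-⊆ᵇ p q s with b
... | true  = refl
... | false = sym (BoolP.∧-zeroʳ (p ⊆ᵇ s))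
∪-⊆ᵇ (inside ∷ p)  (outside ∷ q) (b ∷ s) rewrite ∪-⊆ᵇ p q s = sym (BoolP.∧-assoc b (p ⊆ᵇ s) (q ⊆ᵇ s))
∪-⊆ᵇ (inside ∷ p)  (inside ∷ q)  (b ∷ s) rewrite ∪-⊆ᵇ p q s with b
... | true  = refl
... | false = refl

∪-⟂ : ∀ {n} (p q s : Subset n) → (p ∪ q ⟂ s) ≡ (p ⟂ s) ∧ (q ⟂ s)
∪-⟂ []            []            []      = refl
∪-⟂ (outside ∷ p) (outside ∷ q) (_ ∷ s) = ∪-⟂ p q s
∪-⟂ (outside ∷ p) (inside ∷ q)  (b ∷ s) rewrite ∪-⟂ p q s with b
... | true  = sym (BoolP.∧-zeroʳ (p ⟂ s))
... | false = refl
∪-⟂ (inside ∷ p)  (outside ∷ q) (b ∷ s) rewrite ∪-⟂ p q s = sym (BoolP.∧-assoc (not b) (p ⟂ s) (q ⟂ s))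
∪-⟂ (inside ∷ p)  (inside ∷ q)  (b ∷ s) rewrite ∪-⟂ p q s with b
... | true  = refl
... | false = refl

ind : ∀ {n} → Subset n → Fin n → ℕ
ind s p = 𝟙 (lookup s p)

ind-∪ : ∀ {n} (q t : Subset n) → (q ⟂ t) ≡ true → ∀ p → ind (q ∪ t) p ≡ ind q p + ind t p
ind-∪ (outside ∷ q) (_ ∷ t)       d zero    = refl
ind-∪ (inside ∷ q)  (outside ∷ t) d zero    = refl
ind-∪ (outside ∷ q) (_ ∷ t)       d (suc p) = ind-∪ q t d p
ind-∪ (inside ∷ q)  (outside ∷ t) d (suc p) = ind-∪ q t d p

∪-cancel : ∀ {n} (q s t : Subset n) → (q ⟂ s) ≡ true → (q ⟂ t) ≡ true → q ∪ s ≡ q ∪ t → s ≡ t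
∪-cancel []            []            []            _ _ _  = refl
∪-cancel (outside ∷ q) (b ∷ s)       (c ∷ t)       d e eq =
  cong₂ _∷_ (cong head eq) (∪-cancel q s t d e (cong tail eq))
∪-cancel (inside ∷ q)  (outside ∷ s) (outside ∷ t) d e eq =
  cong (outside ∷_) (∪-cancel q s t d e (cong tail eq))

ind-injective : ∀ {n} (s t : Subset n) → (∀ p → ind s p ≡ ind t p) → s ≡ t
ind-injective []       []       eq = refl
ind-injective (b ∷ s) (c ∷ t) eq = cong₂ _∷_ (𝟙-injective b c (eq zero)) (ind-injective s t (eq ∘ suc))
  where
  𝟙-injective : ∀ b c → 𝟙 b ≡ 𝟙 c → b ≡ c
  𝟙-injective true  true  _ = refl
  𝟙-injective false false _ = refl

∈?-lookup : ∀ {n} (i : Fin n) s → does (i ∈? s) ≡ lookup s i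
∈?-lookup zero    (inside ∷ s)  = refl
∈?-lookup zero    (outside ∷ s) = refl
∈?-lookup (suc i) (_ ∷ s)       = ∈?-lookup i s

length-filter≡∑ : ∀ {A : Set} {P : A → Set} (P? : Decidable P) xs →
  length (filter P? xs) ≡ ∑[ x ← xs ] 𝟙 (does (P? x))
length-filter≡∑ P? xs = trans (sym (∑-one (filter P? xs)))
  (trans (∑-filter P? xs (λ _ → 1)) (∑-cong xs λ x → *-identityʳ (𝟙 (does (P? x)))))

pairCount≡∑ : ∀ {n} (i j : Fin n) B → pairCount i j B ≡ ∑[ b ← B ] (ind b i * ind b j)
pairCount≡∑ i j B = trans (length-filter≡∑ (λ b → (i ∈? b) ×-dec (j ∈? b)) B)
  (∑-cong B λ b → trans (𝟙-∧ (does (i ∈? b)) (does (j ∈? b)))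
    (cong₂ (λ x y → 𝟙 x * 𝟙 y) (∈?-lookup i b) (∈?-lookup j b)))

-- Two-element sets as edges

elements : ∀ {n} → Subset n → List (Fin n)
elements []            = []
elements (outside ∷ s) = map suc (elements s)
elements (inside ∷ s)  = zero ∷ map suc (elements s)

length-elements : ∀ {n} (s : Subset n) → length (elements s) ≡ ∣ s ∣
length-elements []            = refl
length-elements (outside ∷ s) = trans (length-map suc (elements s)) (length-elements s)
length-elements (inside ∷ s)  = cong suc (trans (length-map suc (elements s)) (length-elements s))

elements-unique : ∀ {n} (s : Subset n) → Unique (elements s)
elements-unique []            = []
elements-unique (outside ∷ s) = map⁺ FinP.suc-injective (elements-unique s)
elements-unique (inside ∷ s)  = All.tabulate zero-fresh ∷ map⁺ FinP.suc-injective (elements-unique s)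
  where
  zero-fresh : ∀ {p} → p ∈ map suc (elements s) → zero ≢ p
  zero-fresh p∈ refl with _ , _ , () ← ∈-map⁻ suc p∈

∈-elements : ∀ {n} (s : Subset n) p → lookup s p ≡ true → p ∈ elements s
∈-elements (inside ∷ s)  zero    _  = here refl
∈-elements (outside ∷ s) (suc p) eq = ∈-map⁺ suc (∈-elements s p eq)
∈-elements (inside ∷ s)  (suc p) eq = there (∈-map⁺ suc (∈-elements s p eq))

_==_ : ∀ {n} → Fin n → Fin n → ℕ
x == p = 𝟙 (does (x FinP.≟ p))

∑-elements : ∀ {n} (s : Subset n) p → ∑[ x ← elements s ] (x == p) ≡ ind s p
∑-elements (outside ∷ s) zero    = trans (∑-map suc (elements s) (_== zero)) (∑-zero (elements s))
∑-elements (inside ∷ s)  zero    = cong suc (trans (∑-map suc (elements s) (_== zero)) (∑-zero (elements s)))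
∑-elements (outside ∷ s) (suc p) = trans (∑-map suc (elements s) (_== suc p)) (∑-elements s p)
∑-elements (inside ∷ s)  (suc p) = trans (∑-map suc (elements s) (_== suc p)) (∑-elements s p)

Ends : ∀ {n} → Subset n → Set
Ends e = ∃₂ λ x y → x ≢ y × ∀ p → ind e p ≡ (x == p) + (y == p)

ends : ∀ {n} (e : Subset n) → ∣ e ∣ ≡ 2 → Ends e
ends e two with elements e | length-elements e | elements-unique e | ∑-elements e
... | x ∷ y ∷ [] | _  | (x≢y ∷ []) ∷ _ | sum = x , y , x≢y , λ p →
  trans (sym (sum p)) (cong ((x == p) +_) (+-identityʳ (y == p)))
... | []             | len | _ | _ with () ← trans len two
... | _ ∷ []         | len | _ | _ with () ← trans len two
... | _ ∷ _ ∷ _ ∷ _  | len | _ | _ with () ← trans len two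

module _ {n : ℕ} where
  open SignedGraph (FinP._≟_ {n})

  -- With sign + the vector of the edge is the indicator of the pair, so a dependency is a signing
  -- whose sum at every vertex is zero.
  toEdge : ∀ {e} → Ends e → Edge (Fin n)
  toEdge (x , y , _) = edge x y (fix Sign.+) 0

  toEdges : ∀ {L} → All Ends L → List (Edge (Fin n))
  toEdges []       = []
  toEdges {e ∷ _} (ends ∷ es) = toEdge {e} ends ∷ toEdges es

  valency : List (Subset n) → Fin n → ℕ
  valency P p = ∑[ e ← P ] ind e p

  -- A combination decoded into the sets with coefficient 1 and those with coefficient -1, so that
  -- multiplicities of blocks can be counted in ℕ.
  record Signing (L : List (Subset n)) (nz : Bool) (b : Fin n → ℤ) : Set where
    field
      P⁺ P⁻    : List (Subset n)
      ⊆⁺       : ∀ {e} → e ∈ P⁺ → e ∈ L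
      ⊆⁻       : ∀ {e} → e ∈ P⁻ → e ∈ L
      unique⁺  : Unique P⁺
      unique⁻  : Unique P⁻
      disjoint : ∀ {e} → e ∈ P⁺ → e ∉ P⁻
      nonempty : nz ≡ true → ∃ λ e → e ∈ P⁺ ⊎ e ∈ P⁻
      balance  : ∀ p → b p ≡ ℤ.+ valency P⁺ p ℤ.- ℤ.+ valency P⁻ p

  δ-== : ∀ x p → δ x p ≡ ℤ.+ (x == p)
  δ-== x p with does (x FinP.≟ p)
  ... | true  = refl
  ... | false = refl

  signing : ∀ {L} (es : All Ends L) {nz b} → Unique L → Comb (toEdges es) nz b → Signing L nz b
  signing [] _ (done z) = record
    { P⁺ = [] ; P⁻ = [] ; ⊆⁺ = λ () ; ⊆⁻ = λ () ; unique⁺ = [] ; unique⁻ = []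
    ; disjoint = λ () ; nonempty = λ () ; balance = z }
  signing (_ ∷ es) (_ ∷ u) (skip c) = record
    { Signing s hiding (⊆⁺; ⊆⁻)
    ; ⊆⁺ = there ∘ Signing.⊆⁺ s ; ⊆⁻ = there ∘ Signing.⊆⁻ s }
    where
    s = signing es u c
  signing {L = e ∷ L} ((x , y , x≢y , ie) ∷ es) (e∉ ∷ u) (take {b = b} Sign.+ fixed c q) = record
    { P⁺ = e ∷ P⁺
    ; P⁻ = P⁻
    ; ⊆⁺ = λ { (here refl) → here refl ; (there f∈) → there (⊆⁺ f∈) }
    ; ⊆⁻ = there ∘ ⊆⁻
    ; unique⁺ = All.tabulate (λ f∈ → All.lookup e∉ (⊆⁺ f∈)) ∷ unique⁺
    ; unique⁻ = unique⁻
    ; disjoint = λ { (here refl) f∈ → All.lookup e∉ (⊆⁻ f∈) refl ; (there f∈) → disjoint f∈ }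
    ; nonempty = λ _ → e , inj₁ (here refl)
    ; balance = λ p → begin
        _                                                          ≡⟨ q p ⟩
        Sign.+ · (δ x p ℤ.+ δ y p) ℤ.+ b p                         ≡⟨ cong₂ (λ d b → Sign.+ · d ℤ.+ b) (δ-ends p) (balance p) ⟩
        ℤ.+ ind e p ℤ.+ (ℤ.+ valency P⁺ p ℤ.- ℤ.+ valency P⁻ p) ≡⟨ eq (ℤ.+ ind e p) (ℤ.+ valency P⁺ p) (ℤ.+ valency P⁻ p) ⟩
        (ℤ.+ ind e p ℤ.+ ℤ.+ valency P⁺ p) ℤ.- ℤ.+ valency P⁻ p ∎
    }
    where
    open Signing (signing es u c)
    open ≡-Reasoning
    δ-ends : ∀ p → δ x p ℤ.+ δ y p ≡ ℤ.+ ind e p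
    δ-ends p = trans (cong₂ ℤ._+_ (δ-== x p) (δ-== y p)) (cong ℤ.+_ (sym (ie p)))
    eq : ∀ i a b → i ℤ.+ (a ℤ.- b) ≡ (i ℤ.+ a) ℤ.- b
    eq = ℤSolver.solve-∀
  signing {L = e ∷ L} ((x , y , x≢y , ie) ∷ es) (e∉ ∷ u) (take {b = b} Sign.- fixed c q) = record
    { P⁺ = P⁺
    ; P⁻ = e ∷ P⁻
    ; ⊆⁺ = there ∘ ⊆⁺
    ; ⊆⁻ = λ { (here refl) → here refl ; (there f∈) → there (⊆⁻ f∈) }
    ; unique⁺ = unique⁺
    ; unique⁻ = All.tabulate (λ f∈ → All.lookup e∉ (⊆⁻ f∈)) ∷ unique⁻
    ; disjoint = λ { f∈ (here refl) → All.lookup e∉ (⊆⁺ f∈) refl ; f∈ (there g∈) → disjoint f∈ g∈ }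
    ; nonempty = λ _ → e , inj₂ (here refl)
    ; balance = λ p → begin
        _                                                          ≡⟨ q p ⟩
        Sign.- · (δ x p ℤ.+ δ y p) ℤ.+ b p                         ≡⟨ cong₂ (λ d b → Sign.- · d ℤ.+ b) (δ-ends p) (balance p) ⟩
        ℤ.- (ℤ.+ ind e p) ℤ.+ (ℤ.+ valency P⁺ p ℤ.- ℤ.+ valency P⁻ p) ≡⟨ eq (ℤ.+ ind e p) (ℤ.+ valency P⁺ p) (ℤ.+ valency P⁻ p) ⟩
        ℤ.+ valency P⁺ p ℤ.- (ℤ.+ ind e p ℤ.+ ℤ.+ valency P⁻ p) ∎
    }
    where
    open Signing (signing es u c)
    open ≡-Reasoning
    δ-ends : ∀ p → δ x p ℤ.+ δ y p ≡ ℤ.+ ind e p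
    δ-ends p = trans (cong₂ ℤ._+_ (δ-== x p) (δ-== y p)) (cong ℤ.+_ (sym (ie p)))
    eq : ∀ i a b → ℤ.- i ℤ.+ (a ℤ.- b) ≡ a ℤ.- (i ℤ.+ b)
    eq = ℤSolver.solve-∀

-- Pair coverage of families of blocks

_≟ˢ_ : ∀ {n} (s t : Subset n) → Dec (s ≡ t)
_≟ˢ_ = ≡-dec BoolP._≟_

_∈ₗ?_ : ∀ {n} (s : Subset n) L → Dec (s ∈ L)
_∈ₗ?_ = DecMembership._∈?_ _≟ˢ_

∑-ind : ∀ {n} (e : Subset n) → ∑ (allFin n) (ind e) ≡ ∣ e ∣
∑-ind []      = refl
∑-ind {suc n} (b ∷ e) = trans (cong (𝟙 b +_)
    (trans (cong (λ ps → ∑ ps (ind (b ∷ e))) (sym (map-tabulate (λ i → i) suc)))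
      (trans (∑-map suc (allFin n) (ind (b ∷ e))) (∑-ind e))))
    (first b)
  where
  first : ∀ b → 𝟙 b + ∣ e ∣ ≡ ∣ b ∷ e ∣
  first true  = refl
  first false = refl

∑-valency : ∀ {n} (P : List (Subset n)) → (∀ {e} → e ∈ P → ∣ e ∣ ≡ 2) → ∑ (allFin n) (valency P) ≡ 2 * length P
∑-valency {n} P two = trans (∑-swap (allFin n) P (λ p e → ind e p)) (go P two)
  where
  go : ∀ P → (∀ {e} → e ∈ P → ∣ e ∣ ≡ 2) → ∑[ e ← P ] ∑ (allFin n) (ind e) ≡ 2 * length P
  go []      two = refl
  go (e ∷ P) two = trans (cong₂ _+_ (trans (∑-ind e) (two (here refl))) (go P (two ∘ there))) (sym (*-suc 2 (length P)))

coverage : ∀ {n} → List (Subset n) → Fin n → Fin n → ℕ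
coverage B i j = ∑[ b ← B ] (ind b i * ind b j)

-- Expands (ind X i + ind e i) (ind X j + ind e j). Except for pairs inside the members of `P`, the
-- coverage depends on `P` only through its length and its valencies.
coverage-shifted : ∀ {n} (X : Subset n) P → (∀ {e} → e ∈ P → (X ⟂ e) ≡ true) → ∀ i j →
  coverage (map (X ∪_) P) i j ≡
  ind X i * ind X j * length P + ind X i * valency P j + ind X j * valency P i + coverage P i j
coverage-shifted X [] d i j rewrite *-zeroʳ (ind X i * ind X j) | *-zeroʳ (ind X i) | *-zeroʳ (ind X j) = refl
coverage-shifted X (e ∷ P) d i j
  rewrite ind-∪ X e (d (here refl)) i | ind-∪ X e (d (here refl)) j | coverage-shifted X P (d ∘ there) i j =
  eq (ind X i) (ind X j) (ind e i) (ind e j) (length P) (valency P i) (valency P j) (coverage P i j)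
  where
  eq : ∀ x y a b l p q c →
    (x + a) * (y + b) + (x * y * l + x * q + y * p + c) ≡
    x * y * (1 + l) + x * (b + q) + y * (a + p) + (a * b + c)
  eq = solve-∀

∑-indicator : ∀ {n} (x : Subset n) (g : Subset n → ℕ) → ∑[ s ← subsets n ] (𝟙 (does (s ≟ˢ x)) * g s) ≡ g x
∑-indicator [] g = trans (+-identityʳ _) (+-identityʳ _)
∑-indicator {suc n} (outside ∷ x) g = trans (∑-subsets n _)
  (trans (cong₂ _+_ (∑-indicator x (g ∘ (outside ∷_))) (∑-zero (subsets n))) (+-identityʳ _))
∑-indicator {suc n} (inside ∷ x) g = trans (∑-subsets n _)
  (cong₂ _+_ (∑-zero (subsets n)) (∑-indicator x (g ∘ (inside ∷_))))

∑-member : ∀ {n} {L : List (Subset n)} (g : Subset n → ℕ) → Unique L → ∑[ s ← subsets n ] (𝟙 (does (s ∈ₗ? L)) * g s) ≡ ∑ L g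
∑-member {n} {[]}    g _       = ∑-zero (subsets n)
∑-member {n} {x ∷ L} g (x∉ ∷ u) = begin
  ∑[ s ← subsets n ] (𝟙 (does (s ∈ₗ? (x ∷ L))) * g s)
    ≡⟨ ∑-cong (subsets n) split ⟩
  ∑[ s ← subsets n ] (𝟙 (does (s ≟ˢ x)) * g s + 𝟙 (does (s ∈ₗ? L)) * g s)
    ≡⟨ ∑-+ (subsets n) _ _ ⟩
  ∑[ s ← subsets n ] (𝟙 (does (s ≟ˢ x)) * g s) + ∑[ s ← subsets n ] (𝟙 (does (s ∈ₗ? L)) * g s)
    ≡⟨ cong₂ _+_ (∑-indicator x g) (∑-member g u) ⟩
  g x + ∑ L g ∎
  where
  open ≡-Reasoning
  split : ∀ s → 𝟙 (does (s ∈ₗ? (x ∷ L))) * g s ≡ 𝟙 (does (s ≟ˢ x)) * g s + 𝟙 (does (s ∈ₗ? L)) * g s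
  split s with s ≟ˢ x | s ∈ₗ? L
  ... | yes refl | yes s∈ = ⊥-elim (All.lookup x∉ s∈ refl)
  ... | yes refl | no _   = sym (+-identityʳ _)
  ... | no _     | yes _  = refl
  ... | no _     | no _   = refl

⁅⁆-⊆ᵇ : ∀ {n} (i : Fin n) s → (⁅ i ⁆ ⊆ᵇ s) ≡ lookup s i
⁅⁆-⊆ᵇ {suc n} zero (b ∷ s) = trans (cong (b ∧_) (⊥-⊆ᵇ s)) (BoolP.∧-identityʳ b)
  where
  ⊥-⊆ᵇ : ∀ {n} (s : Subset n) → (⊥ˢ ⊆ᵇ s) ≡ true
  ⊥-⊆ᵇ []      = refl
  ⊥-⊆ᵇ (_ ∷ s) = ⊥-⊆ᵇ s
⁅⁆-⊆ᵇ (suc i) (_ ∷ s) = ⁅⁆-⊆ᵇ i s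

lookup-⁅⁆ : ∀ {n} {i j : Fin n} → i ≢ j → lookup ⁅ i ⁆ j ≡ false
lookup-⁅⁆ {i = zero}  {zero}  i≢j = ⊥-elim (i≢j refl)
lookup-⁅⁆ {i = zero}  {suc j} i≢j = VecP.lookup-replicate j outside
lookup-⁅⁆ {i = suc i} {zero}  i≢j = refl
lookup-⁅⁆ {i = suc i} {suc j} i≢j = lookup-⁅⁆ (i≢j ∘ cong suc)

⁅⁆-⟂ : ∀ {n} {i j : Fin n} → i ≢ j → (⁅ i ⁆ ⟂ ⁅ j ⁆) ≡ true
⁅⁆-⟂ {i = i} {j} i≢j = begin
  ⁅ i ⁆ ⟂ ⁅ j ⁆         ≡⟨ ⟂-sym ⁅ i ⁆ ⁅ j ⁆ ⟩
  ⁅ j ⁆ ⟂ ⁅ i ⁆         ≡⟨ ⟂-∁ ⁅ j ⁆ ⁅ i ⁆ ⟩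
  ⁅ i ⁆ ⊆ᵇ ∁ ⁅ j ⁆      ≡⟨ ⁅⁆-⊆ᵇ i (∁ ⁅ j ⁆) ⟩
  lookup (∁ ⁅ j ⁆) i    ≡⟨ VecP.lookup-map i not ⁅ j ⁆ ⟩
  not (lookup ⁅ j ⁆ i)  ≡⟨ cong not (lookup-⁅⁆ (i≢j ∘ sym)) ⟩
  true                  ∎
  where open ≡-Reasoning

-- A block through i and j is {i, j} ∪ t with t a k-subset of the other v - 2 points; here k is the
-- block size less 2.
full-coverage : ∀ {v} k {i j : Fin v} → i ≢ j →
  ∑[ s ← subsets v ] (size (2 + k) s * (ind s i * ind s j)) ≡ (v ∸ 2) C k
full-coverage {v} k {i} {j} i≢j = begin
  ∑[ s ← subsets v ] (size (2 + k) s * (ind s i * ind s j))  ≡⟨ ∑-cong (subsets v) (λ s → trans (*-comm (size (2 + k) s) _) (cong (_* size (2 + k) s) (contains s))) ⟩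
  ∑[ s ← subsets v ] (𝟙 (pair ⊆ᵇ s) * size (2 + k) s)        ≡⟨ ∑-supersets pair (size (2 + k)) ⟩
  ∑[ t ← subsets v ] (𝟙 (pair ⟂ t) * size (2 + k) (pair ∪ t)) ≡⟨ ∑-cong (subsets v) residual ⟩
  ∑[ t ← subsets v ] (𝟙 (t ⊆ᵇ ∁ pair) * size k t)            ≡⟨ count-subsets (∁ pair) k ⟩
  ∣ ∁ pair ∣ C k                                              ≡⟨ cong (_C k) (trans (∣∁p∣≡n∸∣p∣ pair) (cong (v ∸_) two)) ⟩
  (v ∸ 2) C k                                                 ∎
  where
  open ≡-Reasoning
  pair = ⁅ i ⁆ ∪ ⁅ j ⁆
  two : ∣ pair ∣ ≡ 2
  two = trans (∣∪∣ ⁅ i ⁆ ⁅ j ⁆ (⁅⁆-⟂ i≢j)) (cong₂ _+_ (∣⁅x⁆∣≡1 i) (∣⁅x⁆∣≡1 j))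
  contains : ∀ s → ind s i * ind s j ≡ 𝟙 (pair ⊆ᵇ s)
  contains s = trans (sym (𝟙-∧ (lookup s i) (lookup s j)))
    (cong 𝟙 (trans (cong₂ _∧_ (sym (⁅⁆-⊆ᵇ i s)) (sym (⁅⁆-⊆ᵇ j s))) (sym (∪-⊆ᵇ ⁅ i ⁆ ⁅ j ⁆ s))))
  residual : ∀ t → 𝟙 (pair ⟂ t) * size (2 + k) (pair ∪ t) ≡ 𝟙 (t ⊆ᵇ ∁ pair) * size k t
  residual t rewrite sym (⟂-∁ pair t) with pair ⟂ t in d
  ... | false = refl
  ... | true rewrite ∣∪∣ pair t d | two = refl

∈-subsets : ∀ {n} (s : Subset n) → s ∈ subsets n
∈-subsets []                      = here refl
∈-subsets (outside ∷ s)           = ∈-++⁺ˡ (∈-map⁺ (outside ∷_) (∈-subsets s))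
∈-subsets {suc n} (inside ∷ s)    = ∈-++⁺ʳ (map (outside ∷_) (subsets n)) (∈-map⁺ (inside ∷_) (∈-subsets s))

-- From balanced signings to designs

⟂-lookup : ∀ {n} (q t : Subset n) z → (q ⟂ t) ≡ true → lookup q z ≡ true → lookup t z ≡ false
⟂-lookup (inside ∷ q)  (outside ∷ t) zero    _ _   = refl
⟂-lookup (outside ∷ q) (_ ∷ t)       (suc z) d z∈q = ⟂-lookup q t z d z∈q
⟂-lookup (inside ∷ q)  (outside ∷ t) (suc z) d z∈q = ⟂-lookup q t z d z∈q

shifted-unique : ∀ {n} (X : Subset n) {P} → (∀ {e} → e ∈ P → (X ⟂ e) ≡ true) → Unique P → Unique (map (X ∪_) P)
shifted-unique X {[]}    d _        = []
shifted-unique X {e ∷ P} d (e∉ ∷ u) = All.tabulate fresh ∷ shifted-unique X (d ∘ there) u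
  where
  fresh : ∀ {s} → s ∈ map (X ∪_) P → X ∪ e ≢ s
  fresh s∈ eq with f , f∈ , refl ← ∈-map⁻ (X ∪_) s∈ =
    All.lookup e∉ f∈ (∪-cancel X e f (d (here refl)) (d (there f∈)) eq)

filter-∉-coverage : ∀ {v} k {L : List (Subset v)} → Unique L → (∀ {s} → s ∈ L → ∣ s ∣ ≡ k) → ∀ i j →
  coverage (filter (λ s → (∣ s ∣ ≟ k) ×-dec ¬? (s ∈ₗ? L)) (subsets v)) i j + coverage L i j ≡
  ∑[ s ← subsets v ] (size k s * (ind s i * ind s j))
filter-∉-coverage {v} k {L} u sized i j = begin
  coverage (filter keep? (subsets v)) i j + coverage L i j
    ≡⟨ cong₂ _+_ (∑-filter keep? (subsets v) g) (sym (∑-member g u)) ⟩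
  ∑[ s ← subsets v ] (𝟙 (does (keep? s)) * g s) + ∑[ s ← subsets v ] (𝟙 (does (s ∈ₗ? L)) * g s)
    ≡⟨ ∑-+ (subsets v) _ _ ⟨
  ∑[ s ← subsets v ] (𝟙 (does (keep? s)) * g s + 𝟙 (does (s ∈ₗ? L)) * g s)
    ≡⟨ ∑-cong (subsets v) split ⟩
  ∑[ s ← subsets v ] (size k s * g s) ∎
  where
  open ≡-Reasoning
  keep? : Decidable (λ s → ∣ s ∣ ≡ k × s ∉ L)
  keep? s = (∣ s ∣ ≟ k) ×-dec ¬? (s ∈ₗ? L)
  g : Subset v → ℕ
  g s = ind s i * ind s j
  split : ∀ s → 𝟙 (does (keep? s)) * g s + 𝟙 (does (s ∈ₗ? L)) * g s ≡ size k s * g s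
  split s with s ∈ₗ? L
  ... | no _ rewrite BoolP.∧-identityʳ (∣ s ∣ ≡ᵇ k) = +-identityʳ _
  ... | yes s∈ with ∣ s ∣ ≡ᵇ k in eq
  ...   | true  = refl
  ...   | false with () ← subst T eq (≡⇒≡ᵇ ∣ s ∣ k (sized s∈))

-- The edges of the graph, for X = S ∪ {z} and Y = S ∪ {z′}.
Removable : ∀ {v} → List (Subset v) → Subset v → Subset v → Subset v → Set
Removable D X Y e = ∣ e ∣ ≡ 2 × (X ⟂ e) ≡ true × (Y ⟂ e) ≡ true × X ∪ e ∉ D × Y ∪ e ∉ D

module _ {v j} {D : List (Subset v)} (defining : IsDefiningSet v (2 + j) D)
         (X Y : Subset v) (∣X∣ : ∣ X ∣ ≡ j) (∣Y∣ : ∣ Y ∣ ≡ j)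
         {z} (z∈X : lookup X z ≡ true) (z∉Y : lookup Y z ≡ false) where

  -- In the full design the blocks of `old` drop to multiplicity 0 and those of `new` rise to 2. The
  -- result still contains `D` and would have to be full, but X ∪ e is missing for every e in `P⁻`.
  no-trade : ∀ {L} → Unique L → (∀ {e} → e ∈ L → Removable D X Y e) → (es : All Ends L) →
             ¬ SignedGraph.Trade FinP._≟_ (toEdges es)
  no-trade {L} unique removable es trade = absurd
    where
    open Signing (signing es unique trade)

    size⁺ : ∀ {e} → e ∈ P⁺ → ∣ e ∣ ≡ 2
    size⁺ = proj₁ ∘ removable ∘ ⊆⁺
    size⁻ : ∀ {e} → e ∈ P⁻ → ∣ e ∣ ≡ 2
    size⁻ = proj₁ ∘ removable ∘ ⊆⁻
    X⟂ : ∀ {e} → e ∈ L → (X ⟂ e) ≡ true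
    X⟂ = proj₁ ∘ proj₂ ∘ removable
    Y⟂ : ∀ {e} → e ∈ L → (Y ⟂ e) ≡ true
    Y⟂ = proj₁ ∘ proj₂ ∘ proj₂ ∘ removable

    valency-≡ : ∀ p → valency P⁺ p ≡ valency P⁻ p
    valency-≡ p = ℤP.+-injective (ℤP.i-j≡0⇒i≡j (ℤ.+ valency P⁺ p) (ℤ.+ valency P⁻ p) (sym (balance p)))

    -- Handshake count. It settles the pairs inside X or inside Y, which every shifted edge covers,
    -- and it makes `P⁻` nonempty as soon as `P⁺` is.
    length-≡ : length P⁺ ≡ length P⁻
    length-≡ = *-cancelˡ-≡ (length P⁺) (length P⁻) 2
      (trans (sym (∑-valency P⁺ size⁺)) (trans (∑-cong (allFin v) valency-≡) (∑-valency P⁻ size⁻)))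

    old new rest blocks : List (Subset v)
    old    = map (X ∪_) P⁻ ++ map (Y ∪_) P⁺
    new    = map (X ∪_) P⁺ ++ map (Y ∪_) P⁻
    rest   = filter (λ s → (∣ s ∣ ≟ 2 + j) ×-dec ¬? (s ∈ₗ? old)) (subsets v)
    blocks = rest ++ new

    -- The point z lies in X, hence in no edge, and not in Y; it tells the two families of blocks
    -- apart.
    X∪≢Y∪ : ∀ {e f} → f ∈ L → X ∪ e ≢ Y ∪ f
    X∪≢Y∪ {e} {f} f∈ eq = true≢false (trans (sym z∈X∪e) (trans (cong (λ s → lookup s z) eq) z∉Y∪f))
      where
      true≢false : true ≢ false
      true≢false ()
      z∈X∪e : lookup (X ∪ e) z ≡ true
      z∈X∪e = trans (VecP.lookup-zipWith _∨_ z X e) (cong (_∨ lookup e z) z∈X)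
      z∉Y∪f : lookup (Y ∪ f) z ≡ false
      z∉Y∪f = trans (VecP.lookup-zipWith _∨_ z Y f) (cong₂ _∨_ z∉Y (⟂-lookup X f z (X⟂ f∈) z∈X))

    old-unique : Unique old
    old-unique = ++⁺ (shifted-unique X (X⟂ ∘ ⊆⁻) unique⁻) (shifted-unique Y (Y⟂ ∘ ⊆⁺) unique⁺) apart
      where
      apart : Disjoint (map (X ∪_) P⁻) (map (Y ∪_) P⁺)
      apart (s∈ , s∈′) with _ , _ , refl ← ∈-map⁻ (X ∪_) s∈ with _ , f∈ , eq ← ∈-map⁻ (Y ∪_) s∈′ =
        X∪≢Y∪ (⊆⁺ f∈) eq

    module _ (Z : Subset v) (∣Z∣ : ∣ Z ∣ ≡ j) (Z⟂ : ∀ {e} → e ∈ L → (Z ⟂ e) ≡ true) where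
      shifted-size : ∀ {e} → e ∈ L → ∣ Z ∪ e ∣ ≡ 2 + j
      shifted-size {e} e∈ =
        trans (∣∪∣ Z e (Z⟂ e∈)) (trans (cong₂ _+_ ∣Z∣ (proj₁ (removable e∈))) (+-comm j 2))

      shifted-sizes : ∀ {P} → (∀ {e} → e ∈ P → e ∈ L) → ∀ {s} → s ∈ map (Z ∪_) P → ∣ s ∣ ≡ 2 + j
      shifted-sizes ⊆L s∈ with _ , e∈ , refl ← ∈-map⁻ (Z ∪_) s∈ = shifted-size (⊆L e∈)

    old-size : ∀ {s} → s ∈ old → ∣ s ∣ ≡ 2 + j
    old-size s∈ with ∈-++⁻ (map (X ∪_) P⁻) s∈
    ... | inj₁ s∈X = shifted-sizes X ∣X∣ X⟂ ⊆⁻ s∈X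
    ... | inj₂ s∈Y = shifted-sizes Y ∣Y∣ Y⟂ ⊆⁺ s∈Y

    new-size : ∀ {s} → s ∈ new → ∣ s ∣ ≡ 2 + j
    new-size s∈ with ∈-++⁻ (map (X ∪_) P⁺) s∈
    ... | inj₁ s∈X = shifted-sizes X ∣X∣ X⟂ ⊆⁺ s∈X
    ... | inj₂ s∈Y = shifted-sizes Y ∣Y∣ Y⟂ ⊆⁻ s∈Y

    -- Lengths and valencies agree, so only the pairs inside edges remain; their coverages by `P⁺`
    -- and `P⁻` trade places between X and Y. This is why two points z and z′ are needed.
    old-new : ∀ i k → coverage new i k ≡ coverage old i k
    old-new i k
      rewrite ∑-++ (map (X ∪_) P⁺) (map (Y ∪_) P⁻) (λ b → ind b i * ind b k)
            | ∑-++ (map (X ∪_) P⁻) (map (Y ∪_) P⁺) (λ b → ind b i * ind b k)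
            | coverage-shifted X P⁺ (X⟂ ∘ ⊆⁺) i k | coverage-shifted X P⁻ (X⟂ ∘ ⊆⁻) i k
            | coverage-shifted Y P⁺ (Y⟂ ∘ ⊆⁺) i k | coverage-shifted Y P⁻ (Y⟂ ∘ ⊆⁻) i k
            | length-≡ | valency-≡ i | valency-≡ k =
      eq (common X) (coverage P⁺ i k) (common Y) (coverage P⁻ i k)
      where
      common : Subset v → ℕ
      common Z = ind Z i * ind Z k * length P⁻ + ind Z i * valency P⁻ k + ind Z k * valency P⁻ i
      eq : ∀ a b c d → a + b + (c + d) ≡ a + d + (c + b)
      eq = solve-∀

    design : IsDesign v (2 + j) ((v ∸ 2) C j) blocks
    design = AllP.++⁺ (All.map proj₁ (all-filter _ (subsets v))) (All.tabulate new-size) , λ i k i≢k → begin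
      pairCount i k blocks                       ≡⟨ pairCount≡∑ i k blocks ⟩
      coverage blocks i k                        ≡⟨ ∑-++ rest new _ ⟩
      coverage rest i k + coverage new i k       ≡⟨ cong (coverage rest i k +_) (old-new i k) ⟩
      coverage rest i k + coverage old i k       ≡⟨ filter-∉-coverage (2 + j) old-unique old-size i k ⟩
      ∑[ s ← subsets v ] (size (2 + j) s * (ind s i * ind s k)) ≡⟨ full-coverage j i≢k ⟩
      (v ∸ 2) C j                                ∎
      where open ≡-Reasoning

    old∉D : ∀ {s} → s ∈ old → s ∉ D
    old∉D s∈ with ∈-++⁻ (map (X ∪_) P⁻) s∈
    ... | inj₁ s∈X with _ , e∈ , refl ← ∈-map⁻ (X ∪_) s∈X = proj₁ (proj₂ (proj₂ (proj₂ (removable (⊆⁻ e∈)))))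
    ... | inj₂ s∈Y with _ , e∈ , refl ← ∈-map⁻ (Y ∪_) s∈Y = proj₂ (proj₂ (proj₂ (proj₂ (removable (⊆⁺ e∈)))))

    D⊆blocks : ∀ {s} → s ∈ D → s ∈ blocks
    D⊆blocks {s} s∈D = ∈-++⁺ˡ (∈-filter⁺ _ (∈-subsets s)
      (All.lookup (proj₂ (proj₁ defining)) s∈D , λ s∈old → old∉D s∈old s∈D))

    full : IsFull v (2 + j) blocks
    full = proj₂ defining blocks design D⊆blocks

    ∈-blocks : ∀ s → ∣ s ∣ ≡ 2 + j → s ∈ blocks
    ∈-blocks s sized with filter (λ b → ≡-dec BoolP._≟_ b s) blocks in eq | full s sized
    ... | b ∷ _ | _ with b∈ , refl ← ∈-filter⁻ (λ b → ≡-dec BoolP._≟_ b s) {xs = blocks} (subst (b ∈_) (sym eq) (here refl)) = b∈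

    removed : ∀ {e} → e ∈ P⁻ → ⊥
    removed {e} e∈ with ∈-++⁻ rest (∈-blocks (X ∪ e) (shifted-size X ∣X∣ X⟂ (⊆⁻ e∈)))
    ... | inj₁ s∈rest = proj₂ (proj₂ (∈-filter⁻ (λ s → (∣ s ∣ ≟ 2 + j) ×-dec ¬? (s ∈ₗ? old)) {xs = subsets v} s∈rest))
                          (∈-++⁺ˡ (∈-map⁺ (X ∪_) e∈))
    ... | inj₂ s∈new with ∈-++⁻ (map (X ∪_) P⁺) s∈new
    ...   | inj₁ s∈X with f , f∈ , eq ← ∈-map⁻ (X ∪_) s∈X =
              disjoint (subst (_∈ P⁺) (sym (∪-cancel X e f (X⟂ (⊆⁻ e∈)) (X⟂ (⊆⁺ f∈)) eq)) f∈) e∈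
    ...   | inj₂ s∈Y with f , f∈ , eq ← ∈-map⁻ (Y ∪_) s∈Y = X∪≢Y∪ (⊆⁻ f∈) eq

    P⁻-nonempty : ∃ (_∈ P⁻)
    P⁻-nonempty with nonempty refl
    ... | e , inj₂ e∈ = e , e∈
    ... | e , inj₁ e∈ = pick P⁺ P⁻ e∈ length-≡
      where
      pick : ∀ P Q → e ∈ P → length P ≡ length Q → ∃ (_∈ Q)
      pick (_ ∷ _) (f ∷ _) _ _ = f , here refl

    absurd : ⊥
    absurd = removed (proj₂ P⁻-nonempty)

-- The edge bound for link graphs

==-refl : ∀ {n} (x : Fin n) → (x == x) ≡ 1
==-refl x with x FinP.≟ x
... | yes _ = refl
... | no x≢x = ⊥-elim (x≢x refl)

ind≡suc⇒∈ : ∀ {n} (s : Subset n) p {m} → ind s p ≡ suc m → lookup s p ≡ true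
ind≡suc⇒∈ s p eq with lookup s p
... | true = refl

module _ {n : ℕ} where
  open SignedGraph (FinP._≟_ {n}) using (names; capacity; Proper; Apart; Parallel; bound)
  open SignedGraph (FinP._≟_ {n}) using (Joins; Trade)

  -- Start of the elimination: no vertex is flagged and all weights are 0, so the available units
  -- are 4 per vertex.
  toEdges-bound : ∀ {L} (es : All Ends L) (W : Subset n) → 1 ≤ ∣ W ∣ → Unique L →
    (∀ {e p} → e ∈ L → lookup e p ≡ true → lookup W p ≡ true) →
    Trade (toEdges es) ⊎ 3 * length L + 3 ≤ 4 * ∣ W ∣
  toEdges-bound {L} es W 1≤W unique L⊆W = result
    where
    vs = map (_, false) (elements W)

    names-vs : ∀ xs → names (map (_, false) xs) ≡ xs
    names-vs []       = refl
    names-vs (x ∷ xs) = cong (x ∷_) (names-vs xs)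

    no-loops : ∀ xs → SignedGraph.loops FinP._≟_ (map (_, false) xs) ≡ []
    no-loops []       = refl
    no-loops (x ∷ xs) = no-loops xs

    capacities : ∀ xs → sum (map capacity (map (_, false) xs)) ≡ 4 * length xs
    capacities []       = refl
    capacities (x ∷ xs) = trans (cong (4 +_) (capacities xs)) (sym (*-suc 4 (length xs)))

    weights : ∀ {L} (es : All Ends L) → sum (map Edge.weight (toEdges es)) ≡ 0
    weights []       = refl
    weights (_ ∷ es) = weights es

    length-toEdges : ∀ {L} (es : All Ends L) → length (toEdges es) ≡ length L
    length-toEdges []       = refl
    length-toEdges (_ ∷ es) = cong suc (length-toEdges es)

    ∈W : ∀ {e p} → e ∈ L → lookup e p ≡ true → p ∈ names vs
    ∈W e∈ p∈e = subst (_ ∈_) (sym (names-vs (elements W))) (∈-elements W _ (L⊆W e∈ p∈e))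

    proper : ∀ {K} (es : All Ends K) → (∀ {e} → e ∈ K → e ∈ L) → All (Proper (names vs)) (toEdges es)
    proper [] _ = []
    proper {e ∷ _} ((x , y , x≢y , ie) ∷ es) K⊆L =
      (x≢y , ∈W (K⊆L (here refl)) (ind≡suc⇒∈ e x (trans (ie x) (cong (_+ (y == x)) (==-refl x))))
           , ∈W (K⊆L (here refl)) (ind≡suc⇒∈ e y (trans (ie y) (trans (+-comm (x == y) (y == y)) (cong (_+ (x == y)) (==-refl y))))))
      ∷ proper es (K⊆L ∘ there)

    joins-ind : ∀ {e} (E : Ends e) {a x} → Joins (toEdge {e = e} E) a x → ∀ p → ind e p ≡ (a == p) + (x == p)
    joins-ind (_ , _ , _ , ie) (inj₁ (refl , refl)) p = ie p
    joins-ind (x , y , _ , ie) (inj₂ (refl , refl)) p = trans (ie p) (+-comm (x == p) (y == p))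

    -- A pair is determined by its ends. The graph is simple, so `Apart` holds although no edge is
    -- heavy.
    ¬parallel : ∀ {e f} (E : Ends e) (F : Ends f) → e ≢ f → ¬ Parallel (toEdge {e = e} E) (toEdge {e = f} F)
    ¬parallel {e} {f} E F e≢f (_ , _ , je , jf) =
      e≢f (ind-injective e f λ p → trans (joins-ind {e} E je p) (sym (joins-ind {f} F jf p)))

    apart : ∀ {K} (es : All Ends K) → Unique K → AllPairs Apart (toEdges es)
    apart []       _        = []
    apart {e ∷ K} (E ∷ es) (e∉ ∷ u) = from-e es e∉ ∷ apart es u
      where
      from-e : ∀ {K} (es : All Ends K) → All (e ≢_) K → All (Apart (toEdge {e = e} E)) (toEdges es)
      from-e []       _          = []
      from-e {f ∷ _} (F ∷ fs) (e≢f ∷ e≢) = inj₂ (inj₂ (¬parallel {e} {f} E F e≢f)) ∷ from-e fs e≢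

    len : length vs ≡ suc (pred ∣ W ∣)
    len = trans (length-map (_, false) (elements W)) (trans (length-elements W) (sym (suc-pred ∣ W ∣ {{>-nonZero 1≤W}})))

    result : Trade (toEdges es) ⊎ 3 * length L + 3 ≤ 4 * ∣ W ∣
    result with bound (pred ∣ W ∣) vs (toEdges es) len
                  (subst Unique (sym (names-vs (elements W))) (elements-unique W))
                  (proper es (λ e∈ → e∈)) (apart es unique)
    ... | inj₁ t = inj₁ (subst (λ ls → Trade (ls ++ toEdges es)) (no-loops (elements W)) t)
    ... | inj₂ h = inj₂ (subst₂ (λ l r → 3 * l + 3 ≤ r) (length-toEdges es)
      (trans (cong₂ _+_ (capacities (elements W)) (weights es))
        (trans (+-identityʳ _) (cong (4 *_) (length-elements W)))) h)

-- `W` consists of the points that are not vertices; it will be S ∪ {z, z′}.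
link-bound : ∀ {v j D} → IsDefiningSet v (2 + j) D → ∀ X Y → ∣ X ∣ ≡ j → ∣ Y ∣ ≡ j →
  ∀ {z} → lookup X z ≡ true → lookup Y z ≡ false → ∀ W → 1 ≤ ∣ ∁ W ∣ →
  ∀ {L} → Unique L → (∀ {e} → e ∈ L → Removable D X Y e) → (∀ {e} → e ∈ L → (W ⟂ e) ≡ true) →
  3 * length L + 3 ≤ 4 * ∣ ∁ W ∣
link-bound defining X Y ∣X∣ ∣Y∣ z∈X z∉Y W 1≤ {L} unique removable W⟂ =
  [ (λ t → ⊥-elim (no-trade defining X Y ∣X∣ ∣Y∣ z∈X z∉Y unique removable es t)) , (λ h → h) ]′
    (toEdges-bound es (∁ W) 1≤ unique outside-W)
  where
  es : All Ends L
  es = All.tabulate λ {e} e∈ → ends e (proj₁ (removable e∈))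
  outside-W : ∀ {e p} → e ∈ L → lookup e p ≡ true → lookup (∁ W) p ≡ true
  outside-W {e} {p} e∈ p∈e =
    trans (VecP.lookup-map p not W) (cong not (⟂-lookup e W p (trans (⟂-sym e W) (W⟂ e∈)) p∈e))

subsets-unique : ∀ n → Unique (subsets n)
subsets-unique zero    = [] ∷ []
subsets-unique (suc n) =
  ++⁺ (map⁺ (cong tail) (subsets-unique n)) (map⁺ (cong tail) (subsets-unique n)) apart
  where
  apart : Disjoint (map (outside ∷_) (subsets n)) (map (inside ∷_) (subsets n))
  apart (s∈ , s∈′) with _ , _ , refl ← ∈-map⁻ (outside ∷_) s∈ with _ , _ , () ← ∈-map⁻ (inside ∷_) s∈′

∧-true : ∀ {a b} → a ∧ b ≡ true → a ≡ true × b ≡ true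
∧-true {true} {true} _ = refl , refl

point : ∀ {n} (s : Subset n) → ∣ s ∣ ≡ 1 → ∃ λ z → ∀ p → ind s p ≡ (z == p)
point s one with elements s | length-elements s | ∑-elements s
... | z ∷ []    | _   | sum = z , λ p → trans (sym (sum p)) (+-identityʳ (z == p))
... | []        | len | _ with () ← trans len one
... | _ ∷ _ ∷ _ | len | _ with () ← trans len one

separating-point : ∀ {n} (s t : Subset n) → ∣ s ∣ ≡ 1 → ∣ t ∣ ≡ 1 → s ≢ t → ∃ λ z → lookup s z ≡ true × lookup t z ≡ false
separating-point s t one one′ s≢t with x , is ← point s one | y , it ← point t one′ =
  x , ind≡suc⇒∈ s x (trans (is x) (==-refl x)) , x∉t
  where
  x∉t : lookup t x ≡ false
  x∉t with lookup t x in x∈t | y FinP.≟ x | it x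
  ... | false | _        | _ = refl
  ... | true  | yes refl | _ = ⊥-elim (s≢t (ind-injective s t λ p → trans (is p) (sym (it p))))

distinct-points-⟂ : ∀ {n} (s t : Subset n) → ∣ s ∣ ≡ 1 → ∣ t ∣ ≡ 1 → s ≢ t → (s ⟂ t) ≡ true
distinct-points-⟂ s t one one′ s≢t with s ⟂ t in d
... | true  = refl
... | false = ⊥-elim (common s t d λ z z∈s z∈t → s≢t (ind-injective s t (same z z∈s z∈t)))
  where
  common : ∀ {n} (s t : Subset n) → (s ⟂ t) ≡ false → (∀ z → lookup s z ≡ true → lookup t z ≡ true → ⊥) → ⊥
  common []            []            () k
  common (outside ∷ s) (_ ∷ t)       d k = common s t d (k ∘ suc)
  common (inside ∷ s)  (inside ∷ t)  d k = k zero refl refl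
  common (inside ∷ s)  (outside ∷ t) d k = common s t d (k ∘ suc)
  at : ∀ {n} (s : Subset n) → ∣ s ∣ ≡ 1 → ∀ z → lookup s z ≡ true → ∀ p → ind s p ≡ (z == p)
  at s one z z∈s p with x , is ← point s one with x FinP.≟ z | trans (sym (cong 𝟙 z∈s)) (is z)
  ... | yes refl | _ = is p
  same : ∀ z → lookup s z ≡ true → lookup t z ≡ true → ∀ p → ind s p ≡ ind t p
  same z z∈s z∈t p = trans (at s one z z∈s p) (sym (at t one′ z z∈t p))

does-false : ∀ {A : Set} (d : Dec A) → not (does d) ≡ true → ¬ A
does-false (no ¬a) _ = ¬a

-- Double counting

≡ᵇ-+ : ∀ j a b → (j + a ≡ᵇ j + b) ≡ (a ≡ᵇ b)
≡ᵇ-+ zero    a b = refl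
≡ᵇ-+ (suc j) a b = ≡ᵇ-+ j a b

-- Flags P = B ∖ Z and Z ⊆ B with |Z| = j correspond to each other.
∑-flags : ∀ {n} j m (g : Subset n → Subset n → ℕ) →
  ∑[ P ← subsets n ] ∑[ Z ← subsets n ] (size m P * (size j Z * (𝟙 (Z ⟂ P) * g Z (Z ∪ P)))) ≡
  ∑[ B ← subsets n ] ∑[ Z ← subsets n ] (size (j + m) B * (size j Z * (𝟙 (Z ⊆ᵇ B) * g Z B)))
∑-flags {n} j m g = begin
  ∑[ P ← subsets n ] ∑[ Z ← subsets n ] (size m P * (size j Z * (𝟙 (Z ⟂ P) * g Z (Z ∪ P))))
    ≡⟨ ∑-swap (subsets n) (subsets n) _ ⟩
  ∑[ Z ← subsets n ] ∑[ P ← subsets n ] (size m P * (size j Z * (𝟙 (Z ⟂ P) * g Z (Z ∪ P))))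
    ≡⟨ ∑-cong (subsets n) (λ Z → ∑-cong (subsets n) (join Z)) ⟩
  ∑[ Z ← subsets n ] ∑[ P ← subsets n ] (𝟙 (Z ⟂ P) * (size (j + m) (Z ∪ P) * (size j Z * g Z (Z ∪ P))))
    ≡⟨ ∑-cong (subsets n) (λ Z → ∑-supersets Z (λ B → size (j + m) B * (size j Z * g Z B))) ⟨
  ∑[ Z ← subsets n ] ∑[ B ← subsets n ] (𝟙 (Z ⊆ᵇ B) * (size (j + m) B * (size j Z * g Z B)))
    ≡⟨ ∑-cong (subsets n) (λ Z → ∑-cong (subsets n) λ B → eq (𝟙 (Z ⊆ᵇ B)) (size (j + m) B) (size j Z) (g Z B)) ⟩
  ∑[ Z ← subsets n ] ∑[ B ← subsets n ] (size (j + m) B * (size j Z * (𝟙 (Z ⊆ᵇ B) * g Z B)))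
    ≡⟨ ∑-swap (subsets n) (subsets n) _ ⟩
  ∑[ B ← subsets n ] ∑[ Z ← subsets n ] (size (j + m) B * (size j Z * (𝟙 (Z ⊆ᵇ B) * g Z B))) ∎
  where
  open ≡-Reasoning
  eq : ∀ a b c d → a * (b * (c * d)) ≡ b * (c * (a * d))
  eq = solve-∀
  join : ∀ Z P → size m P * (size j Z * (𝟙 (Z ⟂ P) * g Z (Z ∪ P))) ≡
                 𝟙 (Z ⟂ P) * (size (j + m) (Z ∪ P) * (size j Z * g Z (Z ∪ P)))
  join Z P with Z ⟂ P in d
  ... | false rewrite *-zeroʳ (size j Z) = *-zeroʳ (size m P)
  ... | true with ∣ Z ∣ ≡ᵇ j in ∣Z∣
  ...   | false rewrite *-zeroʳ (size m P) | *-zeroʳ (size (j + m) (Z ∪ P)) = refl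
  ...   | true rewrite ∣∪∣ Z P d | ≡ᵇ⇒≡ ∣ Z ∣ j (Equivalence.from T-≡ ∣Z∣) | ≡ᵇ-+ j ∣ P ∣ m =
    eq′ (size m P) (g Z (Z ∪ P))
    where
    eq′ : ∀ a b → a * (1 * (1 * b)) ≡ 1 * (a * (1 * b))
    eq′ = solve-∀

number : ℕ → ℕ → ℕ
number n j = ∑ (subsets n) (size j)

number≡C : ∀ n j → number n j ≡ n C j
number≡C n j = trans (∑-cong (subsets n) λ s → trans (sym (+-identityʳ (size j s))) (cong (λ b → 𝟙 b * size j s) (sym (⊆ᵇ-⊤ s))))
  (trans (count-subsets (⊤ {n}) j) (cong (_C j) (∣⊤∣≡n n)))
  where
  ⊆ᵇ-⊤ : ∀ {n} (s : Subset n) → (s ⊆ᵇ ⊤) ≡ true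
  ⊆ᵇ-⊤ []            = refl
  ⊆ᵇ-⊤ (outside ∷ s) = ⊆ᵇ-⊤ s
  ⊆ᵇ-⊤ (inside ∷ s)  = ⊆ᵇ-⊤ s

sized-cong : ∀ {n} j (s : Subset n) {a b} → (∣ s ∣ ≡ j → a ≡ b) → size j s * a ≡ size j s * b
sized-cong j s eq with ∣ s ∣ ≡ᵇ j in ∣s∣
... | true  = cong (1 *_) (eq (≡ᵇ⇒≡ ∣ s ∣ j (Equivalence.from T-≡ ∣s∣)))
... | false = refl

∑-*ˡ₂ : ∀ {A B : Set} (xs : List A) (ys : List B) c (f : A → B → ℕ) →
  ∑[ x ← xs ] ∑[ y ← ys ] (c * f x y) ≡ c * ∑[ x ← xs ] ∑[ y ← ys ] f x y
∑-*ˡ₂ xs ys c f = trans (∑-cong xs λ x → ∑-*ˡ ys c (f x)) (∑-*ˡ xs c _)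

-- Each (m + 1)-set arises m + 1 times, once for every point of it that can be added last.
∑-extensions : ∀ {n} m (g : Subset n → ℕ) →
  ∑[ P ← subsets n ] (size m P * ∑[ Z ← subsets n ] (size 1 Z * (𝟙 (Z ⟂ P) * g (Z ∪ P)))) ≡
  suc m * ∑[ B ← subsets n ] (size (suc m) B * g B)
∑-extensions {n} m g = begin
  ∑[ P ← subsets n ] (size m P * ∑[ Z ← subsets n ] (size 1 Z * (𝟙 (Z ⟂ P) * g (Z ∪ P))))
    ≡⟨ ∑-cong (subsets n) (λ P → ∑-*ˡ (subsets n) (size m P) _) ⟨
  ∑[ P ← subsets n ] ∑[ Z ← subsets n ] (size m P * (size 1 Z * (𝟙 (Z ⟂ P) * g (Z ∪ P))))
    ≡⟨ ∑-flags 1 m (λ _ → g) ⟩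
  ∑[ B ← subsets n ] ∑[ Z ← subsets n ] (size (suc m) B * (size 1 Z * (𝟙 (Z ⊆ᵇ B) * g B)))
    ≡⟨ ∑-cong (subsets n) collect ⟩
  ∑[ B ← subsets n ] (suc m * (size (suc m) B * g B))
    ≡⟨ ∑-*ˡ (subsets n) (suc m) _ ⟩
  suc m * ∑[ B ← subsets n ] (size (suc m) B * g B) ∎
  where
  open ≡-Reasoning
  eq : ∀ a b c d → a * (b * (c * d)) ≡ a * d * (c * b)
  eq = solve-∀
  eq′ : ∀ a b c → a * b * c ≡ a * (c * b)
  eq′ = solve-∀
  eq″ : ∀ a b c → a * (c * b) ≡ c * (a * b)
  eq″ = solve-∀
  collect : ∀ B → ∑[ Z ← subsets n ] (size (suc m) B * (size 1 Z * (𝟙 (Z ⊆ᵇ B) * g B))) ≡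
                  suc m * (size (suc m) B * g B)
  collect B = begin
    ∑[ Z ← subsets n ] (size (suc m) B * (size 1 Z * (𝟙 (Z ⊆ᵇ B) * g B)))
      ≡⟨ ∑-cong (subsets n) (λ Z → eq (size (suc m) B) (size 1 Z) (𝟙 (Z ⊆ᵇ B)) (g B)) ⟩
    ∑[ Z ← subsets n ] (size (suc m) B * g B * (𝟙 (Z ⊆ᵇ B) * size 1 Z))
      ≡⟨ ∑-*ˡ (subsets n) (size (suc m) B * g B) _ ⟩
    size (suc m) B * g B * ∑[ Z ← subsets n ] (𝟙 (Z ⊆ᵇ B) * size 1 Z)
      ≡⟨ cong (size (suc m) B * g B *_) (trans (count-subsets B 1) (nC1≡n ∣ B ∣)) ⟩
    size (suc m) B * g B * ∣ B ∣         ≡⟨ eq′ (size (suc m) B) (g B) ∣ B ∣ ⟩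
    size (suc m) B * (∣ B ∣ * g B)       ≡⟨ sized-cong (suc m) B (cong (_* g B)) ⟩
    size (suc m) B * (suc m * g B)       ≡⟨ eq″ (size (suc m) B) (g B) (suc m) ⟩
    suc m * (size (suc m) B * g B)       ∎

count-disjoint : ∀ {n} (P : Subset n) → ∑[ Z ← subsets n ] (size 1 Z * 𝟙 (Z ⟂ P)) ≡ n ∸ ∣ P ∣
count-disjoint {n} P = begin
  ∑[ Z ← subsets n ] (size 1 Z * 𝟙 (Z ⟂ P))    ≡⟨ ∑-cong (subsets n) (λ Z → trans (*-comm (size 1 Z) _) (cong (λ b → 𝟙 b * size 1 Z) (trans (⟂-sym Z P) (⟂-∁ P Z)))) ⟩
  ∑[ Z ← subsets n ] (𝟙 (Z ⊆ᵇ ∁ P) * size 1 Z) ≡⟨ count-subsets (∁ P) 1 ⟩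
  ∣ ∁ P ∣ C 1                                  ≡⟨ nC1≡n ∣ ∁ P ∣ ⟩
  ∣ ∁ P ∣                                      ≡⟨ ∣∁p∣≡n∸∣p∣ P ⟩
  n ∸ ∣ P ∣                                    ∎
  where open ≡-Reasoning

-- Pairs of an m-set and a point outside it, counted by the set and by the union.
number-suc : ∀ n m → number n m * (n ∸ m) ≡ suc m * number n (suc m)
number-suc n m = begin
  number n m * (n ∸ m)                    ≡⟨ ∑-*ʳ (subsets n) (n ∸ m) (size m) ⟨
  ∑[ P ← subsets n ] (size m P * (n ∸ m)) ≡⟨ ∑-cong (subsets n) (λ P → sized-cong m P (λ ∣P∣ → trans (cong (n ∸_) (sym ∣P∣)) (sym (count-disjoint P)))) ⟩
  ∑[ P ← subsets n ] (size m P * ∑[ Z ← subsets n ] (size 1 Z * 𝟙 (Z ⟂ P)))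
    ≡⟨ ∑-cong (subsets n) (λ P → cong (size m P *_) (∑-cong (subsets n) λ Z → cong (size 1 Z *_) (sym (*-identityʳ (𝟙 (Z ⟂ P)))))) ⟩
  ∑[ P ← subsets n ] (size m P * ∑[ Z ← subsets n ] (size 1 Z * (𝟙 (Z ⟂ P) * 1)))
    ≡⟨ ∑-extensions {n} m (λ _ → 1) ⟩
  suc m * ∑[ B ← subsets n ] (size (suc m) B * 1)
    ≡⟨ cong (suc m *_) (∑-cong (subsets n) λ B → *-identityʳ (size (suc m) B)) ⟩
  suc m * number n (suc m) ∎
  where open ≡-Reasoning

-- Splits the diagonal off the double sum.
square-count : ∀ {n} (a : Subset n → Bool) (let A = ∑[ s ← subsets n ] 𝟙 (a s)) →
  A * A ≡ A + ∑[ s ← subsets n ] ∑[ t ← subsets n ] 𝟙 (not (does (t ≟ˢ s)) ∧ a s ∧ a t)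
square-count {n} a = begin
  A * A
    ≡⟨ ∑-product (subsets n) (subsets n) (𝟙 ∘ a) (𝟙 ∘ a) ⟨
  ∑[ s ← subsets n ] ∑[ t ← subsets n ] (𝟙 (a s) * 𝟙 (a t))
    ≡⟨ ∑-cong (subsets n) (λ s → ∑-cong (subsets n) (split s)) ⟩
  ∑[ s ← subsets n ] ∑[ t ← subsets n ] (𝟙 (does (t ≟ˢ s)) * 𝟙 (a t) + 𝟙 (not (does (t ≟ˢ s)) ∧ a s ∧ a t))
    ≡⟨ ∑-cong (subsets n) (λ s → trans (∑-+ (subsets n) _ _) (cong (_+ ∑[ t ← subsets n ] 𝟙 (not (does (t ≟ˢ s)) ∧ a s ∧ a t)) (∑-indicator s (𝟙 ∘ a)))) ⟩
  ∑[ s ← subsets n ] (𝟙 (a s) + ∑[ t ← subsets n ] 𝟙 (not (does (t ≟ˢ s)) ∧ a s ∧ a t))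
    ≡⟨ ∑-+ (subsets n) _ _ ⟩
  A + ∑[ s ← subsets n ] ∑[ t ← subsets n ] 𝟙 (not (does (t ≟ˢ s)) ∧ a s ∧ a t) ∎
  where
  open ≡-Reasoning
  A = ∑[ s ← subsets n ] 𝟙 (a s)
  split : ∀ s t → 𝟙 (a s) * 𝟙 (a t) ≡ 𝟙 (does (t ≟ˢ s)) * 𝟙 (a t) + 𝟙 (not (does (t ≟ˢ s)) ∧ a s ∧ a t)
  split s t with t ≟ˢ s
  ... | no _ = sym (𝟙-∧ (a s) (a t))
  ... | yes refl with a s
  ...   | true  = refl
  ...   | false = refl

2*C2 : ∀ m → 2 * (suc m C 2) ≡ suc m * m
2*C2 zero    = refl
2*C2 (suc m) = begin
  2 * (suc (suc m) C 2)             ≡⟨ cong (2 *_) (nCk+nC[k+1]≡[n+1]C[k+1] (suc m) 1) ⟨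
  2 * (suc m C 1 + suc m C 2)       ≡⟨ *-distribˡ-+ 2 (suc m C 1) (suc m C 2) ⟩
  2 * (suc m C 1) + 2 * (suc m C 2) ≡⟨ cong₂ _+_ (cong (2 *_) (nC1≡n (suc m))) (2*C2 m) ⟩
  2 * suc m + suc m * m             ≡⟨ eq m ⟩
  suc (suc m) * suc m               ∎
  where
  open ≡-Reasoning
  eq : ∀ m → 2 * suc m + suc m * m ≡ suc (suc m) * suc m
  eq = solve-∀

-- Summing the edge bound over all link graphs

module Counting {v m} {D : List (Subset v)} (defining : IsDefiningSet v (3 + m) D) (room : 3 + m ≤ v) where

  N : ℕ
  N = v ∸ (2 + m)

  apart : Subset v → Subset v → Bool
  apart Z Z′ = not (does (Z′ ≟ˢ Z))

  -- The points z and z′ are represented by one-element sets, so all sums run over `subsets v` and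
  -- `∑-flags` treats points and larger sets alike.
  available addable : Subset v → Subset v → Bool
  available Z S    = (∣ Z ∣ ≡ᵇ 1) ∧ (Z ⟂ S)
  addable Z P = available Z P ∧ not (does ((Z ∪ P) ∈ₗ? D))

  addablePairs availablePairs : Subset v → ℕ
  addablePairs P = ∑[ Z ← subsets v ] ∑[ Z′ ← subsets v ] 𝟙 (apart Z Z′ ∧ addable Z P ∧ addable Z′ P)
  availablePairs S    = ∑[ Z ← subsets v ] ∑[ Z′ ← subsets v ] 𝟙 (apart Z Z′ ∧ available Z S ∧ available Z′ S)

  -- Read for fixed S, Z, Z′ it says that Q is an edge; read for fixed P = Q ∪ S it says that Z, Z′
  -- is an ordered pair of distinct points addable to P. The double count compares the two readings.
  link? : (S Z Z′ Q : Subset v) → Bool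
  link? S Z Z′ Q = (∣ Q ∣ ≡ᵇ 2) ∧ (Q ⟂ S) ∧ (apart Z Z′ ∧ addable Z (Q ∪ S) ∧ addable Z′ (Q ∪ S))

  link : (S Z Z′ : Subset v) → List (Subset v)
  link S Z Z′ = filter (T? ∘ link? S Z Z′) (subsets v)

  link-size : ∀ S Z Z′ → ∣ S ∣ ≡ m → apart Z Z′ ∧ available Z S ∧ available Z′ S ≡ true →
    3 * length (link S Z Z′) + 3 ≤ 4 * N
  link-size S Z Z′ ∣S∣ h with ap , h₁ ← ∧-true h with fr , fr′ ← ∧-true h₁
    with one , Z⟂S ← ∧-true fr | one′ , Z′⟂S ← ∧-true fr′ =
    subst (λ n → 3 * length (link S Z Z′) + 3 ≤ 4 * n) ∣∁W∣
      (link-bound defining (Z ∪ S) (Z′ ∪ S) (∣∪S∣ Z ∣Z∣ Z⟂S) (∣∪S∣ Z′ ∣Z′∣ Z′⟂S) z∈X z∉Y W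
        (subst (1 ≤_) (sym ∣∁W∣) (m<n⇒0<n∸m room))
        (filter⁺ (T? ∘ link? S Z Z′) (subsets-unique v))
        (λ Q∈ → removable _ (holds Q∈)) (λ Q∈ → W⟂ _ (holds Q∈)))
    where
    ∣Z∣ : ∣ Z ∣ ≡ 1
    ∣Z∣ = ≡ᵇ⇒≡ ∣ Z ∣ 1 (Equivalence.from T-≡ one)
    ∣Z′∣ : ∣ Z′ ∣ ≡ 1
    ∣Z′∣ = ≡ᵇ⇒≡ ∣ Z′ ∣ 1 (Equivalence.from T-≡ one′)
    Z≢Z′ : Z ≢ Z′
    Z≢Z′ eq = does-false (Z′ ≟ˢ Z) ap (sym eq)
    W = Z ∪ (Z′ ∪ S)

    ∣∪S∣ : ∀ Z → ∣ Z ∣ ≡ 1 → (Z ⟂ S) ≡ true → ∣ Z ∪ S ∣ ≡ 1 + m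
    ∣∪S∣ Z one Z⟂S = trans (∣∪∣ Z S Z⟂S) (cong₂ _+_ one ∣S∣)

    ∣∁W∣ : ∣ ∁ W ∣ ≡ N
    ∣∁W∣ = trans (∣∁p∣≡n∸∣p∣ W) (cong (v ∸_) (trans (∣∪∣ Z (Z′ ∪ S) Z⟂) (cong₂ _+_ ∣Z∣ (∣∪S∣ Z′ ∣Z′∣ Z′⟂S))))
      where
      Z⟂ : (Z ⟂ Z′ ∪ S) ≡ true
      Z⟂ = trans (⟂-sym Z (Z′ ∪ S)) (trans (∪-⟂ Z′ S Z)
        (cong₂ _∧_ (trans (⟂-sym Z′ Z) (distinct-points-⟂ Z Z′ ∣Z∣ ∣Z′∣ Z≢Z′)) (trans (⟂-sym S Z) Z⟂S)))

    sep = separating-point Z Z′ ∣Z∣ ∣Z′∣ Z≢Z′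
    z = proj₁ sep
    z∈X : lookup (Z ∪ S) z ≡ true
    z∈X = trans (VecP.lookup-zipWith _∨_ z Z S) (cong (_∨ lookup S z) (proj₁ (proj₂ sep)))
    z∉Y : lookup (Z′ ∪ S) z ≡ false
    z∉Y = trans (VecP.lookup-zipWith _∨_ z Z′ S)
      (cong₂ _∨_ (proj₂ (proj₂ sep)) (⟂-lookup Z S z Z⟂S (proj₁ (proj₂ sep))))

    holds : ∀ {Q} → Q ∈ link S Z Z′ → link? S Z Z′ Q ≡ true
    holds Q∈ = Equivalence.to T-≡ (proj₂ (∈-filter⁻ (T? ∘ link? S Z Z′) {xs = subsets v} Q∈))

    ⟂-split : ∀ Z Q → (Z ⟂ Q ∪ S) ≡ true → (Z ⟂ Q) ≡ true × (Z ⟂ S) ≡ true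
    ⟂-split Z Q d with q , s ← ∧-true (trans (sym (∪-⟂ Q S Z)) (trans (⟂-sym (Q ∪ S) Z) d)) =
      trans (⟂-sym Z Q) q , trans (⟂-sym Z S) s

    regroup : ∀ Z Q → Z ∪ (Q ∪ S) ≡ (Z ∪ S) ∪ Q
    regroup Z Q = trans (cong (Z ∪_) (∪-comm Q S)) (sym (∪-assoc Z S Q))

    outside-D : ∀ Z Q → not (does ((Z ∪ (Q ∪ S)) ∈ₗ? D)) ≡ true → (Z ∪ S) ∪ Q ∉ D
    outside-D Z Q n = subst (_∉ D) (regroup Z Q) (does-false ((Z ∪ (Q ∪ S)) ∈ₗ? D) n)

    ∪S⟂ : ∀ Z Q → (Z ⟂ Q) ≡ true → (Q ⟂ S) ≡ true → (Z ∪ S ⟂ Q) ≡ true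
    ∪S⟂ Z Q Z⟂Q Q⟂S = trans (∪-⟂ Z S Q) (cong₂ _∧_ Z⟂Q (trans (⟂-sym S Q) Q⟂S))

    removable : ∀ Q → link? S Z Z′ Q ≡ true → Removable D (Z ∪ S) (Z′ ∪ S) Q
    removable Q l with two , l₁ ← ∧-true l with Q⟂S , l₂ ← ∧-true l₁ with _ , l₃ ← ∧-true {apart Z Z′} l₂
      with ad , ad′ ← ∧-true {addable Z (Q ∪ S)} l₃
      with fQ , nD ← ∧-true {available Z (Q ∪ S)} ad | fQ′ , nD′ ← ∧-true {available Z′ (Q ∪ S)} ad′ =
      ≡ᵇ⇒≡ ∣ Q ∣ 2 (Equivalence.from T-≡ two) ,
      ∪S⟂ Z Q (proj₁ (⟂-split Z Q (proj₂ (∧-true {∣ Z ∣ ≡ᵇ 1} fQ)))) Q⟂S ,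
      ∪S⟂ Z′ Q (proj₁ (⟂-split Z′ Q (proj₂ (∧-true {∣ Z′ ∣ ≡ᵇ 1} fQ′)))) Q⟂S ,
      outside-D Z Q nD , outside-D Z′ Q nD′

    W⟂ : ∀ Q → link? S Z Z′ Q ≡ true → (W ⟂ Q) ≡ true
    W⟂ Q l with _ , X⟂Q , Y⟂Q , _ ← removable Q l =
      trans (∪-⟂ Z (Z′ ∪ S) Q) (cong₂ _∧_ (proj₁ (∧-true (trans (sym (∪-⟂ Z S Q)) X⟂Q))) Y⟂Q)

  unused : Subset v → ℕ
  unused s = 𝟙 (not (does (s ∈ₗ? D)))

  p U : ℕ
  p = number v (2 + m)
  U = ∑[ B ← subsets v ] (size (3 + m) B * unused B)

  degree : Subset v → ℕ
  degree P = ∑[ Z ← subsets v ] 𝟙 (addable Z P)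

  G Θ : ℕ
  G = ∑[ P ← subsets v ] (size (2 + m) P * degree P)
  Θ = ∑[ P ← subsets v ] (size (2 + m) P * addablePairs P)

  p*N : p * N ≡ (3 + m) * (v C (3 + m))
  p*N = trans (number-suc v (2 + m)) (cong ((3 + m) *_) (number≡C v (3 + m)))

  G≡ : G ≡ (3 + m) * U
  G≡ = trans (∑-cong (subsets v) λ P → cong (size (2 + m) P *_) (∑-cong (subsets v) (expand P)))
             (∑-extensions (2 + m) unused)
    where
    expand : ∀ P Z → 𝟙 (addable Z P) ≡ size 1 Z * (𝟙 (Z ⟂ P) * unused (Z ∪ P))
    expand P Z = trans (𝟙-∧ (available Z P) _)
      (trans (cong (_* unused (Z ∪ P)) (𝟙-∧ (∣ Z ∣ ≡ᵇ 1) (Z ⟂ P))) (*-assoc (size 1 Z) (𝟙 (Z ⟂ P)) _))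

  U+∣D∣ : U + length D ≡ v C (3 + m)
  U+∣D∣ = begin
    U + length D
      ≡⟨ cong (U +_) (trans (sym (∑-one D)) (sym (∑-member (λ _ → 1) (proj₁ (proj₁ defining))))) ⟩
    U + ∑[ s ← subsets v ] (𝟙 (does (s ∈ₗ? D)) * 1)
      ≡⟨ ∑-+ (subsets v) _ _ ⟨
    ∑[ s ← subsets v ] (size (3 + m) s * unused s + 𝟙 (does (s ∈ₗ? D)) * 1)
      ≡⟨ ∑-cong (subsets v) split ⟩
    number v (3 + m)
      ≡⟨ number≡C v (3 + m) ⟩
    v C (3 + m) ∎
    where
    open ≡-Reasoning
    split : ∀ s → size (3 + m) s * unused s + 𝟙 (does (s ∈ₗ? D)) * 1 ≡ size (3 + m) s
    split s with s ∈ₗ? D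
    ... | no _  = trans (+-identityʳ _) (*-identityʳ (size (3 + m) s))
    ... | yes s∈ rewrite Equivalence.to T-≡ (≡⇒≡ᵇ ∣ s ∣ (3 + m) (All.lookup (proj₂ (proj₁ defining)) s∈)) = refl

  -- The weight is the indicator of the (2 + m)-sets P. As `Θ` sums d (d - 1), `G + Θ` sums d².
  G²≤ : G * G ≤ p * (G + Θ)
  G²≤ = subst (λ q → G * G ≤ p * q) squares (cauchy-schwarz (subsets v) (size (2 + m)) degree)
    where
    squares : ∑[ P ← subsets v ] (size (2 + m) P * (degree P * degree P)) ≡ G + Θ
    squares = trans (∑-cong (subsets v) λ P → trans (cong (size (2 + m) P *_) (square-count (λ Z → addable Z P)))
                      (*-distribˡ-+ (size (2 + m) P) (degree P) (addablePairs P)))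
                    (∑-+ (subsets v) _ _)

  linkPairs : ℕ
  linkPairs = ∑[ S ← subsets v ] (size m S * availablePairs S)

  -- A triple (S, z, z′) amounts to a (2 + m)-set S ∪ {z, z′} with an ordered pair of its points.
  linkPairs≡ : linkPairs ≡ 2 * ((2 + m) C 2) * p
  -- The diagonal pairs are added on both sides, which turns M (M - 1) into M * M.
  linkPairs≡ = +-cancelˡ-≡ (number v m * M) _ _ (begin
    number v m * M + linkPairs       ≡⟨ cong (_+ linkPairs) (∑-*ʳ (subsets v) M (size m)) ⟨
    ∑[ S ← subsets v ] (size m S * M) + linkPairs ≡⟨ ∑-+ (subsets v) _ _ ⟨
    ∑[ S ← subsets v ] (size m S * M + size m S * availablePairs S)
      ≡⟨ ∑-cong (subsets v) (λ S → *-distribˡ-+ (size m S) M (availablePairs S)) ⟨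
    ∑[ S ← subsets v ] (size m S * (M + availablePairs S))
      ≡⟨ ∑-cong (subsets v) (λ S → sized-cong m S (pairs S)) ⟩
    ∑[ S ← subsets v ] (size m S * (M * M)) ≡⟨ ∑-*ʳ (subsets v) (M * M) (size m) ⟩
    number v m * (M * M)                    ≡⟨ cong (λ k → number v m * (M * k)) M≡ ⟩
    number v m * (M * suc M′)               ≡⟨ eq (number v m) M M′ ⟩
    number v m * M + number v m * M * M′    ≡⟨ cong (λ k → number v m * M + k * M′) (number-suc v m) ⟩
    number v m * M + suc m * number v (suc m) * M′ ≡⟨ cong (number v m * M +_) (*-assoc (suc m) (number v (suc m)) M′) ⟩
    number v m * M + suc m * (number v (suc m) * M′) ≡⟨ cong (λ k → number v m * M + suc m * k) (number-suc v (suc m)) ⟩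
    number v m * M + suc m * ((2 + m) * p)  ≡⟨ cong (number v m * M +_) (eq′ m p) ⟩
    number v m * M + (2 + m) * suc m * p    ≡⟨ cong (λ k → number v m * M + k * p) (2*C2 (suc m)) ⟨
    number v m * M + 2 * ((2 + m) C 2) * p  ∎)
    where
    open ≡-Reasoning
    M = v ∸ m
    M′ = v ∸ suc m
    M≡ : M ≡ suc M′
    M≡ = +-∸-assoc 1 {v} {suc m} (≤-trans (m≤n+m (suc m) 2) room)
    eq : ∀ a b c → a * (b * suc c) ≡ a * b + a * b * c
    eq = solve-∀
    eq′ : ∀ m p → suc m * ((2 + m) * p) ≡ (2 + m) * suc m * p
    eq′ = solve-∀
    pairs : ∀ S → ∣ S ∣ ≡ m → M + availablePairs S ≡ M * M
    pairs S ∣S∣ = trans (cong (_+ availablePairs S) (sym count)) (trans (sym (square-count (λ Z → available Z S))) (cong₂ _*_ count count))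
      where
      count : ∑[ Z ← subsets v ] 𝟙 (available Z S) ≡ M
      count = trans (∑-cong (subsets v) λ Z → 𝟙-∧ (∣ Z ∣ ≡ᵇ 1) (Z ⟂ S)) (trans (count-disjoint S) (cong (v ∸_) ∣S∣))

  -- Each P splits as Q ∪ S with a pair Q in C(2 + m, 2) ways, and every split turns an ordered pair
  -- of addable points into an edge Q of the graph of (S, z, z′).
  Θ≡links : ((2 + m) C 2) * Θ ≡ ∑[ S ← subsets v ] (size m S * ∑[ Z ← subsets v ] ∑[ Z′ ← subsets v ] length (link S Z Z′))
  Θ≡links = begin
    ((2 + m) C 2) * Θ
      ≡⟨ ∑-*ˡ (subsets v) ((2 + m) C 2) _ ⟨
    ∑[ P ← subsets v ] (((2 + m) C 2) * (size (2 + m) P * addablePairs P))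
      ≡⟨ ∑-cong (subsets v) (λ P → choose P) ⟩
    ∑[ P ← subsets v ] ∑[ Q ← subsets v ] (size (2 + m) P * (size 2 Q * (𝟙 (Q ⊆ᵇ P) * addablePairs P)))
      ≡⟨ ∑-flags 2 m (λ _ → addablePairs) ⟨
    ∑[ S ← subsets v ] ∑[ Q ← subsets v ] (size m S * (size 2 Q * (𝟙 (Q ⟂ S) * addablePairs (Q ∪ S))))
      ≡⟨ ∑-cong (subsets v) (λ S → trans (∑-*ˡ (subsets v) (size m S) _) (cong (size m S *_) (links S))) ⟩
    ∑[ S ← subsets v ] (size m S * ∑[ Z ← subsets v ] ∑[ Z′ ← subsets v ] length (link S Z Z′)) ∎
    where
    open ≡-Reasoning
    eq : ∀ a b c d → a * b * (c * d) ≡ a * (d * (c * b))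
    eq = solve-∀
    eq′ : ∀ a b c → a * (b * c) ≡ b * c * a
    eq′ = solve-∀
    choose : ∀ P → ((2 + m) C 2) * (size (2 + m) P * addablePairs P) ≡
      ∑[ Q ← subsets v ] (size (2 + m) P * (size 2 Q * (𝟙 (Q ⊆ᵇ P) * addablePairs P)))
    choose P = begin
      ((2 + m) C 2) * (size (2 + m) P * addablePairs P)
        ≡⟨ solve-swap ((2 + m) C 2) (size (2 + m) P) (addablePairs P) ⟩
      size (2 + m) P * (((2 + m) C 2) * addablePairs P)
        ≡⟨ sized-cong (2 + m) P (λ ∣P∣ → cong (λ k → (k C 2) * addablePairs P) (sym ∣P∣)) ⟩
      size (2 + m) P * ((∣ P ∣ C 2) * addablePairs P)
        ≡⟨ solve-swap′ (size (2 + m) P) (∣ P ∣ C 2) (addablePairs P) ⟩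
      size (2 + m) P * addablePairs P * (∣ P ∣ C 2)
        ≡⟨ cong (size (2 + m) P * addablePairs P *_) (count-subsets P 2) ⟨
      size (2 + m) P * addablePairs P * ∑[ Q ← subsets v ] (𝟙 (Q ⊆ᵇ P) * size 2 Q)
        ≡⟨ ∑-*ˡ (subsets v) (size (2 + m) P * addablePairs P) _ ⟨
      ∑[ Q ← subsets v ] (size (2 + m) P * addablePairs P * (𝟙 (Q ⊆ᵇ P) * size 2 Q))
        ≡⟨ ∑-cong (subsets v) (λ Q → eq (size (2 + m) P) (addablePairs P) (𝟙 (Q ⊆ᵇ P)) (size 2 Q)) ⟩
      ∑[ Q ← subsets v ] (size (2 + m) P * (size 2 Q * (𝟙 (Q ⊆ᵇ P) * addablePairs P))) ∎
      where
      solve-swap : ∀ a b c → a * (b * c) ≡ b * (a * c)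
      solve-swap = solve-∀
      solve-swap′ : ∀ a b c → a * (b * c) ≡ a * c * b
      solve-swap′ = solve-∀
    links : ∀ S → ∑[ Q ← subsets v ] (size 2 Q * (𝟙 (Q ⟂ S) * addablePairs (Q ∪ S))) ≡
                  ∑[ Z ← subsets v ] ∑[ Z′ ← subsets v ] length (link S Z Z′)
    links S = begin
      ∑[ Q ← subsets v ] (size 2 Q * (𝟙 (Q ⟂ S) * addablePairs (Q ∪ S)))
        ≡⟨ ∑-cong (subsets v) push ⟩
      ∑[ Q ← subsets v ] ∑[ Z ← subsets v ] ∑[ Z′ ← subsets v ] 𝟙 (link? S Z Z′ Q)
        ≡⟨ ∑-swap (subsets v) (subsets v) _ ⟩
      ∑[ Z ← subsets v ] ∑[ Q ← subsets v ] ∑[ Z′ ← subsets v ] 𝟙 (link? S Z Z′ Q)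
        ≡⟨ ∑-cong (subsets v) (λ Z → ∑-swap (subsets v) (subsets v) _) ⟩
      ∑[ Z ← subsets v ] ∑[ Z′ ← subsets v ] ∑[ Q ← subsets v ] 𝟙 (link? S Z Z′ Q)
        ≡⟨ ∑-cong (subsets v) (λ Z → ∑-cong (subsets v) λ Z′ → length-filter≡∑ (T? ∘ link? S Z Z′) (subsets v)) ⟨
      ∑[ Z ← subsets v ] ∑[ Z′ ← subsets v ] length (link S Z Z′) ∎
      where
      push : ∀ Q → size 2 Q * (𝟙 (Q ⟂ S) * addablePairs (Q ∪ S)) ≡
                   ∑[ Z ← subsets v ] ∑[ Z′ ← subsets v ] 𝟙 (link? S Z Z′ Q)
      push Q = begin
        size 2 Q * (𝟙 (Q ⟂ S) * addablePairs (Q ∪ S))  ≡⟨ *-assoc (size 2 Q) (𝟙 (Q ⟂ S)) _ ⟨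
        size 2 Q * 𝟙 (Q ⟂ S) * addablePairs (Q ∪ S)    ≡⟨ ∑-*ˡ₂ (subsets v) (subsets v) (size 2 Q * 𝟙 (Q ⟂ S)) _ ⟨
        ∑[ Z ← subsets v ] ∑[ Z′ ← subsets v ] (size 2 Q * 𝟙 (Q ⟂ S) * 𝟙 (pair Z Z′))
          ≡⟨ ∑-cong (subsets v) (λ Z → ∑-cong (subsets v) (indicator Z)) ⟨
        ∑[ Z ← subsets v ] ∑[ Z′ ← subsets v ] 𝟙 (link? S Z Z′ Q) ∎
        where
        pair : Subset v → Subset v → Bool
        pair Z Z′ = apart Z Z′ ∧ addable Z (Q ∪ S) ∧ addable Z′ (Q ∪ S)
        indicator : ∀ Z Z′ → 𝟙 (link? S Z Z′ Q) ≡ size 2 Q * 𝟙 (Q ⟂ S) * 𝟙 (pair Z Z′)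
        indicator Z Z′ = trans (𝟙-∧ (∣ Q ∣ ≡ᵇ 2) _)
          (trans (cong (size 2 Q *_) (𝟙-∧ (Q ⟂ S) (pair Z Z′))) (sym (*-assoc (size 2 Q) (𝟙 (Q ⟂ S)) (𝟙 (pair Z Z′)))))

  -- When Z, Z′ are not distinct points outside S, the graph has no edges. Multiplying by the
  -- indicator lets the bound be summed over all Z and Z′.
  link-bound-indicator : ∀ S Z Z′ → ∣ S ∣ ≡ m →
    3 * length (link S Z Z′) + 3 * 𝟙 (apart Z Z′ ∧ available Z S ∧ available Z′ S) ≤
    4 * N * 𝟙 (apart Z Z′ ∧ available Z S ∧ available Z′ S)
  link-bound-indicator S Z Z′ ∣S∣ with apart Z Z′ ∧ available Z S ∧ available Z′ S in h
  ... | true  = ≤-trans (link-size S Z Z′ ∣S∣ h) (≤-reflexive (sym (*-identityʳ (4 * N))))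
  ... | false = ≤-reflexive (trans (+-identityʳ _) (trans (cong (3 *_) empty) (sym (*-zeroʳ (4 * N)))))
    where
    empty : length (link S Z Z′) ≡ 0
    empty = trans (length-filter≡∑ (T? ∘ link? S Z Z′) (subsets v))
      (trans (∑-cong (subsets v) λ Q → cong 𝟙 (absent Q)) (∑-zero (subsets v)))
      where
      absent : ∀ Q → link? S Z Z′ Q ≡ false
      absent Q with link? S Z Z′ Q in l
      ... | false = refl
      ... | true with _ , l₁ ← ∧-true {∣ Q ∣ ≡ᵇ 2} l with _ , l₂ ← ∧-true {Q ⟂ S} l₁ with ap , l₃ ← ∧-true {apart Z Z′} l₂
        with ad , ad′ ← ∧-true {addable Z (Q ∪ S)} l₃
        with trans (sym h) (cong₂ _∧_ ap (cong₂ _∧_ (shrink Z ad) (shrink Z′ ad′)))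
        where
        shrink : ∀ Z → addable Z (Q ∪ S) ≡ true → available Z S ≡ true
        shrink Z ad with one , d ← ∧-true {∣ Z ∣ ≡ᵇ 1} (proj₁ (∧-true {available Z (Q ∪ S)} ad)) =
          cong₂ _∧_ one (trans (⟂-sym Z S) (proj₂ (∧-true {Q ⟂ Z} (trans (sym (∪-⟂ Q S Z)) (trans (⟂-sym (Q ∪ S) Z) d)))))
      ...   | ()

  -- Sums 3 |E| + 3 ≤ 4 N over all triples. The factor C(2 + m, 2) is common to both counts and
  -- cancels; the order of z and z′ doubles 3 and 4 N.
  Θ-bound : 3 * Θ + 6 * p ≤ 8 * N * p
  Θ-bound = *-cancelˡ-≤ ((2 + m) C 2) {{>-nonZero C2>0}} (begin
    c * (3 * Θ + 6 * p)                ≡⟨ eq c Θ p ⟩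
    3 * (c * Θ) + 3 * (2 * c * p)      ≡⟨ cong₂ (λ x y → 3 * x + 3 * y) Θ≡links (sym linkPairs≡) ⟩
    3 * ∑[ S ← subsets v ] (size m S * links S) + 3 * linkPairs
      ≡⟨ cong₂ _+_ (∑-*ˡ (subsets v) 3 _) (∑-*ˡ (subsets v) 3 _) ⟨
    ∑[ S ← subsets v ] (3 * (size m S * links S)) + ∑[ S ← subsets v ] (3 * (size m S * availablePairs S))
      ≡⟨ ∑-+ (subsets v) _ _ ⟨
    ∑[ S ← subsets v ] (3 * (size m S * links S) + 3 * (size m S * availablePairs S))
      ≤⟨ ∑-mono (subsets v) per-S ⟩
    ∑[ S ← subsets v ] (4 * N * (size m S * availablePairs S))
      ≡⟨ ∑-*ˡ (subsets v) (4 * N) _ ⟩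
    4 * N * linkPairs                  ≡⟨ cong (4 * N *_) linkPairs≡ ⟩
    4 * N * (2 * c * p)                ≡⟨ eq′ N c p ⟩
    c * (8 * N * p)                    ∎)
    where
    open ≤-Reasoning
    c = (2 + m) C 2
    links : Subset v → ℕ
    links S = ∑[ Z ← subsets v ] ∑[ Z′ ← subsets v ] length (link S Z Z′)
    eq : ∀ c Θ p → c * (3 * Θ + 6 * p) ≡ 3 * (c * Θ) + 3 * (2 * c * p)
    eq = solve-∀
    eq′ : ∀ N c p → 4 * N * (2 * c * p) ≡ c * (8 * N * p)
    eq′ = solve-∀
    C2>0 : 0 < (2 + m) C 2
    C2>0 = *-cancelˡ-< 2 0 c (subst (0 <_) (sym (2*C2 (suc m))) (s≤s z≤n))
    pairs-bound : ∀ S → ∣ S ∣ ≡ m → 3 * links S + 3 * availablePairs S ≤ 4 * N * availablePairs S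
    pairs-bound S ∣S∣ = begin
      3 * links S + 3 * availablePairs S
        ≡⟨ cong₂ _+_ (∑-*ˡ₂ (subsets v) (subsets v) 3 _) (∑-*ˡ₂ (subsets v) (subsets v) 3 _) ⟨
      ∑[ Z ← subsets v ] ∑[ Z′ ← subsets v ] (3 * length (link S Z Z′)) + ∑[ Z ← subsets v ] ∑[ Z′ ← subsets v ] (3 * h Z Z′)
        ≡⟨ trans (∑-cong (subsets v) λ Z → ∑-+ (subsets v) _ _) (∑-+ (subsets v) _ _) ⟨
      ∑[ Z ← subsets v ] ∑[ Z′ ← subsets v ] (3 * length (link S Z Z′) + 3 * h Z Z′)
        ≤⟨ ∑-mono (subsets v) (λ Z → ∑-mono (subsets v) λ Z′ → link-bound-indicator S Z Z′ ∣S∣) ⟩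
      ∑[ Z ← subsets v ] ∑[ Z′ ← subsets v ] (4 * N * h Z Z′)
        ≡⟨ ∑-*ˡ₂ (subsets v) (subsets v) (4 * N) _ ⟩
      4 * N * availablePairs S ∎
      where
      h : Subset v → Subset v → ℕ
      h Z Z′ = 𝟙 (apart Z Z′ ∧ available Z S ∧ available Z′ S)
    per-S : ∀ S → 3 * (size m S * links S) + 3 * (size m S * availablePairs S) ≤ 4 * N * (size m S * availablePairs S)
    per-S S with ∣ S ∣ ≡ᵇ m in ∣S∣
    ... | false = z≤n
    ... | true rewrite *-identityˡ (links S) | *-identityˡ (availablePairs S) =
      pairs-bound S (≡ᵇ⇒≡ ∣ S ∣ m (Equivalence.from T-≡ ∣S∣))

  -- The quadratic inequality

  defining-bound : BoundHolds v (3 + m) (length D)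
  defining-bound = conclude (2 * (n + 1) * (bin ∸ length D) ≤? bin)
    where
    k n bin a : ℕ
    k   = 3 + m
    n   = v ∸ k
    bin = v C k
    a   = 2 * (n + 1) * (bin ∸ length D)

    N≡ : N ≡ n + 1
    N≡ = trans (+-∸-assoc 1 {v} {k} room) (+-comm 1 n)

    bin∸∣D∣ : bin ∸ length D ≡ U
    bin∸∣D∣ = trans (cong (_∸ length D) (sym U+∣D∣)) (m+n∸n≡m U (length D))

    ka : k * a ≡ (n + 1) * (2 * G)
    ka = trans (cong (λ u → k * (2 * (n + 1) * u)) bin∸∣D∣) (trans (eq k (n + 1) U) (cong (λ g → (n + 1) * (2 * g)) (sym G≡)))
      where
      eq : ∀ k n u → k * (2 * n * u) ≡ n * (2 * (k * u))
      eq = solve-∀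

    kbin : k * bin ≡ (n + 1) * p
    kbin = trans (sym p*N) (trans (cong (p *_) N≡) (*-comm p (n + 1)))

    -- With c = a - bin and e = 2 G - p one has k c = (n + 1) e.
    conclude : Dec (a ≤ bin) → BoundHolds v k (length D)
    conclude (yes a≤bin) = inj₁ a≤bin
    conclude (no a≰bin) = inj₂ (*-cancelˡ-≤ (k * k) (begin
      k * k * (3 * c ^ 2)                          ≡⟨ lhs k c ⟩
      3 * ((k * c) * (k * c))                      ≡⟨ cong (λ x → 3 * (x * x)) kc ⟩
      3 * ((n + 1) * e * ((n + 1) * e))            ≡⟨ mid (n + 1) e ⟩
      (n + 1) * (n + 1) * (3 * (e * e))            ≤⟨ *-monoʳ-≤ ((n + 1) * (n + 1)) e-bound ⟩
      (n + 1) * (n + 1) * (p * p * (32 * n + 11))  ≡⟨ rhs (n + 1) p (32 * n + 11) ⟩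
      (n + 1) * p * ((n + 1) * p) * (32 * n + 11)  ≡⟨ cong (λ x → x * x * (32 * n + 11)) kbin ⟨
      k * bin * (k * bin) * (32 * n + 11)          ≡⟨ rhs′ k bin (32 * n + 11) ⟩
      k * k * (bin ^ 2 * (32 * n + 11))            ∎))
      where
      open ≤-Reasoning
      c e : ℕ
      c = a ∸ bin
      e = 2 * G ∸ p

      kc : k * c ≡ (n + 1) * e
      kc = trans (*-distribˡ-∸ k a bin) (trans (cong₂ _∸_ ka kbin) (sym (*-distribˡ-∸ (n + 1) (2 * G) p)))

      p≤2G : p ≤ 2 * G
      p≤2G = *-cancelˡ-≤ (n + 1) {{>-nonZero (m≤n+m 1 n)}}
        (subst₂ _≤_ kbin ka (*-monoʳ-≤ k (<⇒≤ (≰⇒> a≰bin))))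

      2G≡ : p + e ≡ 2 * G
      2G≡ = m+[n∸m]≡n p≤2G

      -- Completes the square in 12 G² ≤ 12 p (G + Θ). The added 24 p² supplies the 6 p of
      -- `Θ-bound`, which is used 4 p times; together with the 3 p² from 3 (p + e)² it gives the 27
      -- p² carried on both sides.
      e-bound : 3 * (e * e) ≤ p * p * (32 * n + 11)
      e-bound = +-cancelˡ-≤ (27 * (p * p) + 6 * (p * e)) _ _ (begin
        27 * (p * p) + 6 * (p * e) + 3 * (e * e)            ≡⟨ eq₁ p e ⟩
        3 * ((p + e) * (p + e)) + 24 * (p * p)              ≡⟨ cong (λ x → 3 * (x * x) + 24 * (p * p)) 2G≡ ⟩
        3 * (2 * G * (2 * G)) + 24 * (p * p)                ≡⟨ eq₂ p G ⟩
        12 * (G * G) + 24 * (p * p)                         ≤⟨ +-monoˡ-≤ (24 * (p * p)) (*-monoʳ-≤ 12 G²≤) ⟩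
        12 * (p * (G + Θ)) + 24 * (p * p)                   ≡⟨ eq₃ p G Θ ⟩
        6 * (p * (2 * G)) + 4 * p * (3 * Θ + 6 * p)         ≤⟨ +-monoʳ-≤ (6 * (p * (2 * G))) (*-monoʳ-≤ (4 * p) Θ-bound) ⟩
        6 * (p * (2 * G)) + 4 * p * (8 * N * p)             ≡⟨ cong₂ (λ x y → 6 * (p * x) + 4 * p * (8 * y * p)) (sym 2G≡) N≡ ⟩
        6 * (p * (p + e)) + 4 * p * (8 * (n + 1) * p)       ≡⟨ eq₄ p e n ⟩
        27 * (p * p) + 6 * (p * e) + p * p * (32 * n + 11)  ∎)
        where
        eq₁ : ∀ p e → 27 * (p * p) + 6 * (p * e) + 3 * (e * e) ≡ 3 * ((p + e) * (p + e)) + 24 * (p * p)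
        eq₁ = solve-∀
        eq₂ : ∀ p G → 3 * (2 * G * (2 * G)) + 24 * (p * p) ≡ 12 * (G * G) + 24 * (p * p)
        eq₂ = solve-∀
        eq₃ : ∀ p G Θ → 12 * (p * (G + Θ)) + 24 * (p * p) ≡ 6 * (p * (2 * G)) + 4 * p * (3 * Θ + 6 * p)
        eq₃ = solve-∀
        eq₄ : ∀ p e n → 6 * (p * (p + e)) + 4 * p * (8 * (n + 1) * p) ≡ 27 * (p * p) + 6 * (p * e) + p * p * (32 * n + 11)
        eq₄ = solve-∀

      lhs : ∀ k c → k * k * (3 * (c * (c * 1))) ≡ 3 * ((k * c) * (k * c))
      lhs = solve-∀
      mid : ∀ n e → 3 * (n * e * (n * e)) ≡ n * n * (3 * (e * e))
      mid = solve-∀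
      rhs : ∀ n p x → n * n * (p * p * x) ≡ n * p * (n * p) * x
      rhs = solve-∀
      rhs′ : ∀ k b x → k * b * (k * b) * x ≡ k * k * (b * (b * 1) * x)
      rhs′ = solve-∀

theorem3p5 : (v k : ℕ) → 3 ≤ k → k < v →
    (D : List (Subset v)) → IsDefiningSet v k D →
    BoundHolds v k (length D)
theorem3p5 v (suc (suc (suc m))) 3≤k@(s≤s (s≤s (s≤s _))) k<v D defining = Counting.defining-bound defining (<⇒≤ k<v)
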